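{- Let $r\ge1$ and $n\ge1$. The number of $r$-permutations $\pi$ of $[n]$ such that $S(S(\pi))$ is the identity permutation $12\cdots n$ equals $$2(r+1)\frac{((2r+1)n)!}{n!\,(2rn+2)!}.$$
   Context: An $r$-permutation of a finite set $A$ of positive integers is a word in which each element of $A$ appears exactly $r$ times such that whenever $i<j<k$ and $a_i=a_k$ we have $a_j\le a_i$; for $A=[n]$ it is an $r$-permutation of $[n]$. Stack sorting $S$: on words with distinct letters, $S(\emptyset)=\emptyset$ and $S(\pi_lm\pi_r)=S(\pi_l)S(\pi_r)m$ where $m$ is the largest letter; on a nonempty $r$-permutation $\pi$ with largest letter $m$, written $\pi=\alpha_1m\alpha_2m\cdots m\alpha_{r+1}$, $S(\pi)=S(\alpha_1)\cdots S(\alpha_{r+1})m$, and $S(\emptyset)=\emptyset$. -}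

module Defs where

open import Data.Nat using (ℕ; zero; suc; _+_; _*_; _≤_; _<_; _⊔_; _≡ᵇ_)
open import Data.Bool using (if_then_else_)
open import Data.List using (List; []; _∷_; _++_; [_]; length; lookup; concatMap; applyUpTo; foldr)
open import Data.List.Membership.Propositional using (_∈_)
open import Data.List.Relation.Unary.Unique.Propositional using (Unique)
open import Data.Fin as Fin using (Fin)
open import Data.Product using (_×_; ∃)
open import Function.Bundles using (_⇔_)
open import Relation.Binary.PropositionalEquality using (_≡_)

occ : ℕ → List ℕ → ℕ
occ a []       = 0
occ a (x ∷ xs) = (if x ≡ᵇ a then 1 else 0) + occ a xs

-- largest letter of a word (0 for the empty word; letters are positive)
maxL : List ℕ → ℕ
maxL = foldr _⊔_ 0

splitOn : ℕ → List ℕ → List (List ℕ)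
splitOn m []       = [] ∷ []
splitOn m (x ∷ xs) with splitOn m xs
... | []       = [ x ∷ [] ]   -- unreachable
... | b ∷ bs   = if x ≡ᵇ m then [] ∷ b ∷ bs else (x ∷ b) ∷ bs

-- Stack sorting with fuel:  S(∅) = ∅,
-- S(α₁ m α₂ m ⋯ m α_{k+1}) = S(α₁) ⋯ S(α_{k+1}) m  with m the largest letter.
-- For words with distinct letters (k = 1) this is S(πₗ m πᵣ) = S(πₗ)S(πᵣ)m,
-- for r-permutations (k = r) it is the r-permutation rule.
-- Each block is strictly shorter than the word, so fuel = length suffices.
Sf : ℕ → List ℕ → List ℕ
Sf zero    w = []
Sf (suc k) [] = []
Sf (suc k) (x ∷ xs) =
  let w = x ∷ xs ; m = maxL w in concatMap (Sf k) (splitOn m w) ++ [ m ]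

S : List ℕ → List ℕ
S w = Sf (length w) w

IsRPerm : ℕ → ℕ → List ℕ → Set
IsRPerm r n π =
  (∀ a → a ∈ π → 1 ≤ a × a ≤ n)
  × (∀ a → 1 ≤ a → a ≤ n → occ a π ≡ r)
  × (∀ (i j k : Fin (length π)) → i Fin.< j → j Fin.< k →
       lookup π i ≡ lookup π k → lookup π j ≤ lookup π i)

idPerm : ℕ → List ℕ
idPerm n = applyUpTo suc n

{-# OPTIONS --safe #-}
module Submission where

-- Let E(n, k) be the number of lists of k possibly empty words on n letters, r copies of each, all
-- copies of a letter nested in one word, such that S sorts the concatenation of their images under S.
-- The largest letter cuts the word containing it into r + 1 blocks.  These blocks and the words to
-- the left form a list of the same kind on the smallest letters, the words to the right one on the
-- remaining letters, and since S(l m r) = S(l) S(r) m this is reversible: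
--   E(n + 1, k + 1) = Σ_{i ≤ k} Σ_{a + b = n} E(a, r + 1 + i) E(b, k - i).
-- Put γ = 1 + t γ^(2r+1), and let p, q be the series in y with p q = y and γ (p + q) = 1 + (2γ - 1) y,
-- where q has constant term 0.  Then Σ E(n, k) tⁿ yᵏ = γʳ pʳ / (1 - q): t times the sum of this series
-- and its conjugate under p ↔ q is a polynomial of degree r in y, which yields the recurrence.
-- The coefficient of y is γ - r (γ - 1)², and the powers of γ have explicit coefficients.

open import Algebra.Bundles using (CommutativeRing)
open import Data.Integer as ℤ using (ℤ; +_; -[1+_]; _⊖_; 0ℤ; 1ℤ)
import Data.Integer.Properties as ℤₚ
open import Data.Maybe using (Maybe; just; nothing)
open import Data.Nat as ℕ using (ℕ; zero; suc; z≤n; s≤s; _≤_; _<_; _≡ᵇ_; _!)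
open import Data.Nat.Induction using (<-rec)
import Data.Nat.Properties as ℕₚ
open import Data.Product using (Σ; ∃-syntax; _×_; _,_; proj₁; proj₂)
open import Data.Sum using (_⊎_; inj₁; inj₂; [_,_]′)
open import Function using (_∘_)
open import Relation.Binary.PropositionalEquality as ≡ using (_≡_; _≢_)
open import Relation.Nullary using (¬_; yes; no)
open import Relation.Nullary.Decidable using (dec-true; dec-false)

-- Formal power series

-- Lists of words are forced: the images of the blocks and of the words to the left are sorted
-- jointly, so single words are not closed under removal of the largest letter. The obstacle is that
-- the recurrence expresses coefficient k + 1 of y through coefficients from r + 1 on. Write E for
-- the series in y, Eⱼ for its coefficients, and P = yʳ + t Σ_{j ≤ r} Eⱼ yʲ. The recurrence then
-- says t E² - P E + yʳ / (1 - y) = 0, a quadratic equation with r + 1 unknown series E₀, ..., Eᵣ in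
-- t. Its second root E′ satisfies E + E′ = P / t and E E′ = yʳ / (t (1 - y)). Conversely, a sum of
-- degree r in y, this product and the constant term 1 give the recurrence back. So the unknown
-- series are never solved for: an explicit pair of roots is exhibited and these properties are
-- checked. Checking is enough, because the recurrence lowers n and, together with the values at n =
-- 0 and at k = 0, determines all counts.

module PowerSeries {c ℓ} (R : CommutativeRing c ℓ) where
  open CommutativeRing R
  open import Algebra.Properties.Semiring.Exp semiring using (_^_)
  open import Algebra.Properties.CommutativeSemigroup +-commutativeSemigroup using (interchange)
  open import Relation.Binary.Reasoning.Setoid setoid

  Series : Set c
  Series = ℕ → Carrier

  -- A summand depending on both indices, instead of a product of two sequences, lets the same sum
  -- serve the product of series, the double sum of the recurrence and the enumeration in
  -- `enum-conv`.
  conv : (ℕ → ℕ → Carrier) → ℕ → Carrier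
  conv h zero    = h 0 0
  conv h (suc n) = h 0 (suc n) + conv (λ i j → h (suc i) j) n

  infix 4 _≋_
  _≋_ : Series → Series → Set ℓ
  f ≋ g = ∀ n → f n ≈ g n

  infixl 7 _✶_
  _✶_ : Series → Series → Series
  f ✶ g = conv (λ i j → f i * g j)

  infixl 6 _⊞_
  _⊞_ : Series → Series → Series
  (f ⊞ g) n = f n + g n

  ⊟_ : Series → Series
  (⊟ f) n = - f n

  infixr 5 _◂_
  _◂_ : Carrier → Series → Series
  (a ◂ f) zero    = a
  (a ◂ f) (suc n) = f n

  𝟘 : Series
  𝟘 _ = 0#

  const : Carrier → Series
  const a = a ◂ 𝟘

  X : Series
  X = 0# ◂ const 1#

  tail : Series → Series
  tail f n = f (suc n)

  conv-cong-antidiagonal : ∀ n {h h'} → (∀ i j → i ℕ.+ j ≡ n → h i j ≈ h' i j) → conv h n ≈ conv h' n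
  conv-cong-antidiagonal zero    eq = eq 0 0 ≡.refl
  conv-cong-antidiagonal (suc n) eq =
    +-cong (eq 0 (suc n) ≡.refl) (conv-cong-antidiagonal n (λ i j i+j≡n → eq (suc i) j (≡.cong suc i+j≡n)))

  conv-cong : ∀ n {h h'} → (∀ i j → h i j ≈ h' i j) → conv h n ≈ conv h' n
  conv-cong n eq = conv-cong-antidiagonal n (λ i j _ → eq i j)

  conv-+ : ∀ n h h' → conv (λ i j → h i j + h' i j) n ≈ conv h n + conv h' n
  conv-+ zero    h h' = refl
  conv-+ (suc n) h h' = trans (+-congˡ (conv-+ n _ _)) (interchange _ _ _ _)

  conv-*ˡ : ∀ n a h → conv (λ i j → a * h i j) n ≈ a * conv h n
  conv-*ˡ zero    a h = refl
  conv-*ˡ (suc n) a h = trans (+-congˡ (conv-*ˡ n a _)) (sym (distribˡ _ _ _))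

  conv-0 : ∀ n h → (∀ i j → h i j ≈ 0#) → conv h n ≈ 0#
  conv-0 zero    h eq = eq 0 0
  conv-0 (suc n) h eq = trans (+-cong (eq 0 (suc n)) (conv-0 n _ (λ i j → eq (suc i) j))) (+-identityˡ 0#)

  conv-last : ∀ n h → conv h (suc n) ≈ conv (λ i j → h i (suc j)) n + h (suc n) 0
  conv-last zero    h = refl
  conv-last (suc n) h = trans (+-congˡ (conv-last n (λ i j → h (suc i) j))) (sym (+-assoc _ _ _))

  conv-flip : ∀ n h → conv h n ≈ conv (λ i j → h j i) n
  conv-flip zero    h = refl
  conv-flip (suc n) h = begin
    h 0 (suc n) + conv (λ i j → h (suc i) j) n  ≈⟨ +-comm _ _ ⟩
    conv (λ i j → h (suc i) j) n + h 0 (suc n)  ≈⟨ +-congʳ (conv-flip n _) ⟩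
    conv (λ i j → h (suc j) i) n + h 0 (suc n)  ≈⟨ conv-last n (λ i j → h j i) ⟨
    conv (λ i j → h j i) (suc n)                ∎

  ✶-cong : ∀ {f f' g g'} → f ≋ f' → g ≋ g' → f ✶ g ≋ f' ✶ g'
  ✶-cong ff gg n = conv-cong n (λ i j → *-cong (ff i) (gg j))

  ✶-comm : ∀ f g → f ✶ g ≋ g ✶ f
  ✶-comm f g n = trans (conv-flip n _) (conv-cong n (λ i j → *-comm _ _))

  ✶-distribʳ : ∀ f g h → (g ⊞ h) ✶ f ≋ (g ✶ f) ⊞ (h ✶ f)
  ✶-distribʳ f g h n = trans (conv-cong n (λ i j → distribʳ _ _ _)) (conv-+ n _ _)

  ✶-scale : ∀ a f g n → ((λ i → a * f i) ✶ g) n ≈ a * (f ✶ g) n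
  ✶-scale a f g n = trans (conv-cong n (λ i j → *-assoc _ _ _)) (conv-*ˡ n a _)

  const-✶ : ∀ a f n → (const a ✶ f) n ≈ a * f n
  const-✶ a f zero    = refl
  const-✶ a f (suc n) = trans (+-congˡ (conv-0 n _ (λ i j → zeroˡ _))) (+-identityʳ _)

  -- Induction on the index with `f` replaced by its tail: by definition, the tail of `f ✶ g` is
  -- `f 0` times the tail of `g`, plus `tail f ✶ g`.
  ✶-assoc : ∀ f g h → (f ✶ g) ✶ h ≋ f ✶ (g ✶ h)
  ✶-assoc f g h zero    = *-assoc _ _ _
  ✶-assoc f g h (suc n) = begin
    f 0 * g 0 * h (suc n) + (tail (f ✶ g) ✶ h) n
      ≈⟨ +-cong (*-assoc _ _ _) (✶-distribʳ h (λ i → f 0 * g (suc i)) (tail f ✶ g) n) ⟩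
    f 0 * (g 0 * h (suc n)) + (((λ i → f 0 * g (suc i)) ✶ h) n + ((tail f ✶ g) ✶ h) n)
      ≈⟨ +-congˡ (+-cong (✶-scale (f 0) (tail g) h n) (✶-assoc (tail f) g h n)) ⟩
    f 0 * (g 0 * h (suc n)) + (f 0 * (tail g ✶ h) n + (tail f ✶ (g ✶ h)) n)
      ≈⟨ +-assoc _ _ _ ⟨
    f 0 * (g 0 * h (suc n)) + f 0 * (tail g ✶ h) n + (tail f ✶ (g ✶ h)) n
      ≈⟨ +-congʳ (distribˡ _ _ _) ⟨
    f 0 * (g ✶ h) (suc n) + (tail f ✶ (g ✶ h)) n ∎

  ✶-identityˡ : ∀ f → const 1# ✶ f ≋ f
  ✶-identityˡ f n = trans (const-✶ 1# f n) (*-identityˡ _)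

  series : CommutativeRing c ℓ
  series = record
    { Carrier = Series ; _≈_ = _≋_ ; _+_ = _⊞_ ; _*_ = _✶_ ; -_ = ⊟_ ; 0# = 𝟘 ; 1# = const 1#
    ; isCommutativeRing = record
      { isRing = record
        { +-isAbelianGroup = record
          { isGroup = record
            { isMonoid = record
              { isSemigroup = record
                { isMagma = record
                  { isEquivalence = record
                    { refl = λ _ → refl ; sym = λ eq n → sym (eq n) ; trans = λ eq eq' n → trans (eq n) (eq' n) }
                  ; ∙-cong = λ eq eq' n → +-cong (eq n) (eq' n) }
                ; assoc = λ _ _ _ _ → +-assoc _ _ _ }
              ; identity = (λ _ _ → +-identityˡ _) , (λ _ _ → +-identityʳ _) }
            ; inverse = (λ _ _ → -‿inverseˡ _) , (λ _ _ → -‿inverseʳ _)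
            ; ⁻¹-cong = λ eq n → -‿cong (eq n) }
          ; comm = λ _ _ _ → +-comm _ _ }
        ; *-cong = ✶-cong
        ; *-assoc = ✶-assoc
        ; *-identity = ✶-identityˡ , (λ f n → trans (✶-comm f (const 1#) n) (✶-identityˡ f n))
        ; distrib = (λ f g h n → trans (✶-comm f (g ⊞ h) n)
                       (trans (✶-distribʳ f g h n) (+-cong (✶-comm g f n) (✶-comm h f n))))
                  , ✶-distribʳ }
      ; *-comm = ✶-comm } }

  open import Algebra.Properties.Semiring.Exp (CommutativeRing.semiring series) using ()
    renaming (_^_ to _^ˢ_) public

  X-✶ : ∀ f → X ✶ f ≋ 0# ◂ f
  X-✶ f zero    = zeroˡ _
  X-✶ f (suc n) = trans (+-cong (zeroˡ _) (✶-identityˡ f n)) (+-identityˡ _)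

  head-tail : ∀ f → f ≋ const (f 0) ⊞ X ✶ tail f
  head-tail f zero    = sym (trans (+-congˡ (X-✶ (tail f) 0)) (+-identityʳ _))
  head-tail f (suc n) = sym (trans (+-congˡ (X-✶ (tail f) (suc n))) (+-identityˡ _))

  X^-✶ : ∀ d f n → ((X ^ˢ d) ✶ f) (d ℕ.+ n) ≈ f n
  X^-✶ zero    f n = ✶-identityˡ f n
  X^-✶ (suc d) f n = trans (✶-assoc X (X ^ˢ d) f (suc d ℕ.+ n)) (trans (X-✶ _ (suc d ℕ.+ n)) (X^-✶ d f n))

  const-+ : ∀ a b → const (a + b) ≋ const a ⊞ const b
  const-+ a b zero    = refl
  const-+ a b (suc n) = sym (+-identityˡ _)

  const-* : ∀ a b → const (a * b) ≋ const a ✶ const b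
  const-* a b zero    = refl
  const-* a b (suc n) = sym (trans (const-✶ a (const b) (suc n)) (zeroʳ _))

  const-cong : ∀ {a b} → a ≈ b → const a ≋ const b
  const-cong eq zero    = eq
  const-cong eq (suc n) = refl

  const-^ : ∀ a d → const (a ^ d) ≋ const a ^ˢ d
  const-^ a zero    _ = refl
  const-^ a (suc d) n = trans (const-* a (a ^ d) n) (✶-cong {const a} (λ _ → refl) (const-^ a d) n)

  Deg≤ : ℕ → Series → Set ℓ
  Deg≤ d f = ∀ n → d ℕ.< n → f n ≈ 0#

  Agree : ℕ → Series → Series → Set ℓ
  Agree n f g = ∀ k → k ℕ.< n → f k ≈ g k

  -- Plays the part of a contraction: prefixing a head to `Ψ f` shifts by one, so each iteration
  -- settles one more coefficient. The series defined by an equation f = a + X Ψ(f), namely `γ`, `u`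
  -- and `geometric`, are all obtained in this way.
  Causal : (Series → Series) → Set _
  Causal Ψ = ∀ n f g → Agree n f g → Agree n (Ψ f) (Ψ g)

  ✶-agree : ∀ {n f f' g g'} → Agree n f f' → Agree n g g' → Agree n (f ✶ g) (f' ✶ g')
  ✶-agree ff gg k k<n = conv-cong-antidiagonal k λ i j i+j≡k →
    *-cong (ff i (ℕₚ.≤-<-trans (ℕₚ.≤-trans (ℕₚ.m≤m+n i j) (ℕₚ.≤-reflexive i+j≡k)) k<n))
           (gg j (ℕₚ.≤-<-trans (ℕₚ.≤-trans (ℕₚ.m≤n+m j i) (ℕₚ.≤-reflexive i+j≡k)) k<n))

  ^-causal : ∀ d → Causal (_^ˢ d)
  ^-causal zero    n f g fg k k<n = refl
  ^-causal (suc d) n f g fg = ✶-agree fg (^-causal d n f g fg)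

  module Fixpoint (a : Carrier) (Ψ : Series → Series) (causal : Causal Ψ) where
    approx : ℕ → Series
    approx zero    = 𝟘
    approx (suc n) = a ◂ Ψ (approx n)

    -- The limit of the approximations, read off diagonally: coefficient n no longer changes from
    -- approximation n + 1 on.
    fix : Series
    fix n = approx (suc n) n

    approx-step : ∀ n → Agree n (approx n) (approx (suc n))
    approx-step (suc n) zero    _         = refl
    approx-step (suc n) (suc k) (s≤s k<n) = causal n _ _ (approx-step n) k k<n

    approx-fix : ∀ n → Agree n (approx n) fix
    approx-fix (suc n) k (s≤s k≤n) with ℕₚ.m≤n⇒m<n∨m≡n k≤n
    ... | inj₁ k<n    = trans (sym (approx-step n k k<n)) (approx-fix n k k<n)
    ... | inj₂ ≡.refl = refl

    fix-tail : tail fix ≋ Ψ fix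
    fix-tail n = causal (suc n) _ _ (approx-fix (suc n)) n ℕₚ.≤-refl

    fix-equation : fix ≋ const a ⊞ X ✶ Ψ fix
    fix-equation n = trans (head-tail fix n) (+-congˡ (✶-cong {X} (λ _ → refl) fix-tail n))

-- Ring identities with integer coefficients

module IntegerSolver {c ℓ} (R : CommutativeRing c ℓ) where
  open CommutativeRing R
  open import Algebra.Properties.Ring ring
  open import Algebra.Properties.Semiring.Mult.TCOptimised semiring using (×-homo-+; ×1-homo-*; 1+×) renaming (_×_ to _·_)
  open import Algebra.Solver.Ring.AlmostCommutativeRing using (fromCommutativeRing; _-Raw-AlmostCommutative⟶_)
  open import Relation.Binary.Reasoning.Setoid setoid

  -- The canonical map from ℤ. Normal forms need decidable coefficients, and equality of power
  -- series is not decidable.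
  ⟦_⟧ᶻ : ℤ → Carrier
  ⟦ + n ⟧ᶻ      = n · 1#
  ⟦ -[1+ n ] ⟧ᶻ = - (suc n · 1#)

  ⊖-homo : ∀ m n → ⟦ m ⊖ n ⟧ᶻ ≈ m · 1# - n · 1#
  ⊖-homo m zero = begin
    m · 1#      ≈⟨ +-identityʳ _ ⟨
    m · 1# + 0# ≈⟨ +-congˡ -0#≈0# ⟨
    m · 1# - 0# ∎
  ⊖-homo zero (suc n) = sym (+-identityˡ _)
  ⊖-homo (suc m) (suc n) = begin
    ⟦ suc m ⊖ suc n ⟧ᶻ                 ≈⟨ reflexive (≡.cong ⟦_⟧ᶻ (ℤₚ.[1+m]⊖[1+n]≡m⊖n m n)) ⟩
    ⟦ m ⊖ n ⟧ᶻ                         ≈⟨ ⊖-homo m n ⟩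
    m · 1# - n · 1#                    ≈⟨ +-congʳ (xyx⁻¹≈y 1# (m · 1#)) ⟨
    (1# + m · 1# - 1#) - n · 1#        ≈⟨ +-assoc _ _ _ ⟩
    (1# + m · 1#) + (- 1# - n · 1#)    ≈⟨ +-congˡ (-‿+-comm 1# (n · 1#)) ⟩
    (1# + m · 1#) - (1# + n · 1#)      ≈⟨ +-cong (1+× m 1#) (-‿cong (1+× n 1#)) ⟨
    suc m · 1# - suc n · 1#            ∎

  -‿homo : ∀ i → ⟦ ℤ.- i ⟧ᶻ ≈ - ⟦ i ⟧ᶻ
  -‿homo (+ zero)  = sym -0#≈0#
  -‿homo (+ suc n) = refl
  -‿homo -[1+ n ]  = sym (-‿involutive _)

  +-homo : ∀ i j → ⟦ i ℤ.+ j ⟧ᶻ ≈ ⟦ i ⟧ᶻ + ⟦ j ⟧ᶻ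
  +-homo (+ m)    (+ n)    = ×-homo-+ 1# m n
  +-homo (+ m)    -[1+ n ] = ⊖-homo m (suc n)
  +-homo -[1+ m ] (+ n)    = trans (⊖-homo n (suc m)) (+-comm _ _)
  +-homo -[1+ m ] -[1+ n ] = begin
    - (suc (suc (m ℕ.+ n)) · 1#)          ≈⟨ -‿cong (reflexive (≡.cong (λ k → suc k · 1#) (≡.sym (ℕₚ.+-suc m n)))) ⟩
    - ((suc m ℕ.+ suc n) · 1#)            ≈⟨ -‿cong (×-homo-+ 1# (suc m) (suc n)) ⟩
    - (suc m · 1# + suc n · 1#)           ≈⟨ -‿+-comm _ _ ⟨
    - (suc m · 1#) - suc n · 1#           ∎
    where import Data.Nat.Properties as ℕₚ

  *-homo⁺ : ∀ m j → ⟦ + m ℤ.* j ⟧ᶻ ≈ m · 1# * ⟦ j ⟧ᶻ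
  *-homo⁺ m (+ n) = trans (reflexive (≡.cong ⟦_⟧ᶻ (≡.sym (ℤₚ.pos-* m n)))) (×1-homo-* m n)
  *-homo⁺ m -[1+ n ] = begin
    ⟦ + m ℤ.* -[1+ n ] ⟧ᶻ       ≈⟨ reflexive (≡.cong ⟦_⟧ᶻ (≡.sym (ℤₚ.neg-distribʳ-* (+ m) (+ suc n)))) ⟩
    ⟦ ℤ.- (+ m ℤ.* + suc n) ⟧ᶻ  ≈⟨ -‿homo (+ m ℤ.* + suc n) ⟩
    - ⟦ + m ℤ.* + suc n ⟧ᶻ      ≈⟨ -‿cong (*-homo⁺ m (+ suc n)) ⟩
    - (m · 1# * suc n · 1#)     ≈⟨ -‿distribʳ-* _ _ ⟩
    m · 1# * - (suc n · 1#)     ∎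

  *-homo : ∀ i j → ⟦ i ℤ.* j ⟧ᶻ ≈ ⟦ i ⟧ᶻ * ⟦ j ⟧ᶻ
  *-homo (+ m)    j = *-homo⁺ m j
  *-homo -[1+ m ] j = begin
    ⟦ -[1+ m ] ℤ.* j ⟧ᶻ         ≈⟨ reflexive (≡.cong ⟦_⟧ᶻ (≡.sym (ℤₚ.neg-distribˡ-* (+ suc m) j))) ⟩
    ⟦ ℤ.- (+ suc m ℤ.* j) ⟧ᶻ    ≈⟨ -‿homo (+ suc m ℤ.* j) ⟩
    - ⟦ + suc m ℤ.* j ⟧ᶻ        ≈⟨ -‿cong (*-homo⁺ (suc m) j) ⟩
    - (suc m · 1# * ⟦ j ⟧ᶻ)     ≈⟨ -‿distribˡ-* _ _ ⟩
    - (suc m · 1#) * ⟦ j ⟧ᶻ     ∎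

  homomorphism : ℤ.+-*-rawRing -Raw-AlmostCommutative⟶ fromCommutativeRing R
  homomorphism = record
    { ⟦_⟧ = ⟦_⟧ᶻ ; +-homo = +-homo ; *-homo = *-homo ; -‿homo = -‿homo
    ; 0-homo = refl ; 1-homo = refl }

  _≟ᶻ_ : ∀ i j → Maybe (⟦ i ⟧ᶻ ≈ ⟦ j ⟧ᶻ)
  i ≟ᶻ j with i ℤ.≟ j
  ... | yes i≡j = just (reflexive (≡.cong ⟦_⟧ᶻ i≡j))
  -- This claims no inequality: distinct integers may have equal images in `R`.
  ... | no _    = nothing

  open import Algebra.Solver.Ring ℤ.+-*-rawRing (fromCommutativeRing R) homomorphism _≟ᶻ_ public
    using (Polynomial; solve; _:=_; con; _:+_; _:*_; _:-_; :-_)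

  one : ∀ {m} → Polynomial m
  one = con (+ 1)

-- The catalytic equation

module Quadratic {c ℓ} (R : CommutativeRing c ℓ) where
  open CommutativeRing R
  open import Algebra.Properties.Semiring.Exp semiring using (_^_; ^-congˡ)
  open import Algebra.Properties.CommutativeSemiring.Exp commutativeSemiring using (^-distrib-*)
  open import Relation.Binary.Reasoning.Setoid setoid
  open IntegerSolver R

  2# : Carrier
  2# = 1# + 1#

  -- (pⁿ(1 − p) + qⁿ(1 − q)) / (1 − X) as a polynomial of degree n in X, by Newton's recurrence.
  F : Carrier → Carrier → ℕ → Carrier
  F δ X zero          = 2# - δ
  F δ X (suc zero)    = δ * (1# - δ) + (2# - δ) * ((2# - δ) * X)
  F δ X (suc (suc n)) = (δ + (2# - δ) * X) * F δ X (suc n) - X * F δ X n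

  module _ {δ X p q : Carrier} (p+q : p + q ≈ δ + (2# - δ) * X) (pq : p * q ≈ X) where
    -- At X = 1 the two relations become p + q = 2 and p q = 1, with double root 1, which is why 1 -
    -- X divides the left side. Both sides obey the two-term recurrence with coefficients p + q and
    -- - p q, so two initial cases suffice.
    power-differences : ∀ n → p ^ n * (1# - p) + q ^ n * (1# - q) ≈ (1# - X) * F δ X n
    power-differences zero = begin
      1# * (1# - p) + 1# * (1# - q)
        ≈⟨ solve 2 (λ p q → one :* (one :- p) :+ one :* (one :- q) := con (+ 2) :- (p :+ q)) refl p q ⟩
      2# - (p + q)
        ≈⟨ +-congˡ (-‿cong p+q) ⟩
      2# - (δ + (2# - δ) * X)
        ≈⟨ solve 2 (λ d x → con (+ 2) :- (d :+ (con (+ 2) :- d) :* x) := (one :- x) :* (con (+ 2) :- d)) refl δ X ⟩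
      (1# - X) * (2# - δ) ∎
    power-differences (suc zero) = begin
      p * 1# * (1# - p) + q * 1# * (1# - q)
        ≈⟨ solve 2 (λ p q → p :* one :* (one :- p) :+ q :* one :* (one :- q)
                         := (p :+ q) :* (one :- (p :+ q)) :+ con (+ 2) :* (p :* q)) refl p q ⟩
      (p + q) * (1# - (p + q)) + 2# * (p * q)
        ≈⟨ +-cong (*-cong p+q (+-congˡ (-‿cong p+q))) (*-congˡ pq) ⟩
      (δ + (2# - δ) * X) * (1# - (δ + (2# - δ) * X)) + 2# * X
        ≈⟨ solve 2 (λ d x → (d :+ (con (+ 2) :- d) :* x) :* (one :- (d :+ (con (+ 2) :- d) :* x)) :+ con (+ 2) :* x
                         := (one :- x) :* (d :* (one :- d) :+ (con (+ 2) :- d) :* ((con (+ 2) :- d) :* x))) refl δ X ⟩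
      (1# - X) * F δ X 1 ∎
    power-differences (suc (suc n)) = begin
      p * (p * p ^ n) * (1# - p) + q * (q * q ^ n) * (1# - q)
        ≈⟨ solve 4 (λ p q P Q → p :* (p :* P) :* (one :- p) :+ q :* (q :* Q) :* (one :- q)
             := (p :+ q) :* (p :* P :* (one :- p) :+ q :* Q :* (one :- q))
                :- p :* q :* (P :* (one :- p) :+ Q :* (one :- q))) refl p q (p ^ n) (q ^ n) ⟩
      (p + q) * (p ^ suc n * (1# - p) + q ^ suc n * (1# - q)) - p * q * (p ^ n * (1# - p) + q ^ n * (1# - q))
        ≈⟨ +-cong (*-cong p+q (power-differences (suc n))) (-‿cong (*-cong pq (power-differences n))) ⟩
      (δ + (2# - δ) * X) * ((1# - X) * F δ X (suc n)) - X * ((1# - X) * F δ X n)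
        ≈⟨ solve 4 (λ e x a b → e :* ((one :- x) :* a) :- x :* ((one :- x) :* b) := (one :- x) :* (e :* a :- x :* b))
             refl (δ + (2# - δ) * X) X (F δ X (suc n)) (F δ X n) ⟩
      (1# - X) * F δ X (suc (suc n)) ∎

  1^ : ∀ n → 1# ^ n ≈ 1#
  1^ zero    = refl
  1^ (suc n) = trans (*-identityˡ _) (1^ n)

  inverse-^ : ∀ {a b} n → a * b ≈ 1# → a ^ n * b ^ n ≈ 1#
  inverse-^ {a} {b} n ab = trans (sym (^-distrib-* a b n)) (trans (^-congˡ n ab) (1^ n))

  module Branches (r : ℕ) {t γ δ X p u g h : Carrier}
    (γδ : γ * δ ≈ 1#) (γ-eq : γ ≈ 1# + t * (γ * (γ ^ r * γ ^ r)))
    (p+q : p + X * u ≈ δ + (2# - δ) * X) (pu : p * u ≈ 1#)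
    (g-eq : g * (1# - X * u) ≈ 1#) (h-eq : h * (1# - X) ≈ 1#)
    where

    -- With q = X u, exchanging p and q turns E into a conjugate E′ with t E′ = Xʳ Ê; in terms of Ê
    -- no division by t is needed.
    E Ê : Carrier
    E = γ ^ r * (p ^ r * g)
    Ê = δ ^ r * (u ^ r * ((1# - X * u) * h))

    -- The factors γʳ, pʳ and `g` of `E` are inverse to δʳ, uʳ and 1 - X u in `Ê`. This product is
    -- the source of the convolution in `E-recurrence`.
    product : Ê * E ≈ h
    product = begin
      δ ^ r * (u ^ r * ((1# - X * u) * h)) * (γ ^ r * (p ^ r * g))
        ≈⟨ solve 7 (λ D U Q h G P g → D :* (U :* (Q :* h)) :* (G :* (P :* g))
             := (G :* D) :* ((P :* U) :* ((g :* Q) :* h))) refl (δ ^ r) (u ^ r) (1# - X * u) h (γ ^ r) (p ^ r) g ⟩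
      (γ ^ r * δ ^ r) * ((p ^ r * u ^ r) * ((g * (1# - X * u)) * h))
        ≈⟨ *-cong (inverse-^ r γδ) (*-cong (inverse-^ r pu) (*-congʳ g-eq)) ⟩
      1# * (1# * (1# * h))
        ≈⟨ solve 1 (λ h → one :* (one :* (one :* h)) := h) refl h ⟩
      h ∎

    pq : p * (X * u) ≈ X
    pq = trans (solve 3 (λ p x u → p :* (x :* u) := x :* (p :* u)) refl p X u) (trans (*-congˡ pu) (*-identityʳ X))

    -- It is (γ - 1) / γ, and the equation of γ supplies the numerator.
    1-δ : 1# - δ ≈ t * (γ ^ r * γ ^ r)
    1-δ = begin
      1# - δ ≈⟨ +-congʳ γδ ⟨
      γ * δ - δ ≈⟨ solve 2 (λ c d → c :* d :- d := (c :- one) :* d) refl γ δ ⟩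
      (γ - 1#) * δ ≈⟨ *-congʳ (+-congʳ γ-eq) ⟩
      (1# + t * (γ * (γ ^ r * γ ^ r)) - 1#) * δ
        ≈⟨ solve 4 (λ t c G d → (one :+ t :* (c :* (G :* G)) :- one) :* d := (c :* d) :* (t :* (G :* G))) refl t γ (γ ^ r) δ ⟩
      (γ * δ) * (t * (γ ^ r * γ ^ r)) ≈⟨ *-congʳ γδ ⟩
      1# * (t * (γ ^ r * γ ^ r)) ≈⟨ *-identityˡ _ ⟩
      t * (γ ^ r * γ ^ r) ∎

    -- In `t-scaled` this trades t / (1 - q) for (1 - p) / (1 - X), up to powers of γ. By its
    -- symmetry in p and q it also explains `Ê`: 1 - p has no inverse, since 1 - δ is a multiple of
    -- t, but t / (1 - p) makes sense as a multiple of (1 - q) / (1 - X).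
    complements : (1# - p) * (1# - X * u) ≈ t * (γ ^ r * γ ^ r) * (1# - X)
    complements = begin
      (1# - p) * (1# - X * u)
        ≈⟨ solve 2 (λ p q → (one :- p) :* (one :- q) := one :- (p :+ q) :+ p :* q) refl p (X * u) ⟩
      1# - (p + X * u) + p * (X * u)
        ≈⟨ +-cong (+-congˡ (-‿cong p+q)) pq ⟩
      1# - (δ + (2# - δ) * X) + X
        ≈⟨ solve 2 (λ d x → one :- (d :+ (con (+ 2) :- d) :* x) :+ x := (one :- d) :* (one :- x)) refl δ X ⟩
      (1# - δ) * (1# - X)
        ≈⟨ *-congʳ 1-δ ⟩
      t * (γ ^ r * γ ^ r) * (1# - X) ∎

    t-scaled : (t * E) * (1# - X) ≈ δ ^ r * (p ^ r * (1# - p))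
    t-scaled = begin
      (t * (G * (P * g))) * (1# - X)
        ≈⟨ *-identityˡ _ ⟨
      -- Inserting γʳ δʳ = 1 produces the square γʳ γʳ that `complements` asks for.
      1# * ((t * (G * (P * g))) * (1# - X))
        ≈⟨ *-congʳ GD ⟨
      (G * D) * ((t * (G * (P * g))) * (1# - X))
        ≈⟨ solve 6 (λ G D t P g y → (G :* D) :* ((t :* (G :* (P :* g))) :* y) := D :* (P :* ((t :* (G :* G) :* y) :* g)))
             refl G D t P g (1# - X) ⟩
      D * (P * ((t * (G * G) * (1# - X)) * g))
        ≈⟨ *-congˡ (*-congˡ (*-congʳ complements)) ⟨
      D * (P * (((1# - p) * (1# - X * u)) * g))
        ≈⟨ *-congˡ (*-congˡ (trans (*-assoc _ _ _) (*-congˡ (trans (*-comm _ _) g-eq)))) ⟩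
      D * (P * ((1# - p) * 1#))
        ≈⟨ *-congˡ (*-congˡ (*-identityʳ _)) ⟩
      D * (P * (1# - p)) ∎
      where
      G = γ ^ r
      D = δ ^ r
      P = p ^ r
      GD = inverse-^ r γδ

    -- Multiplied by 1 - X, the two summands become δʳ zʳ (1 - z) for z = p and z = q, so
    -- `power-differences` applies; the factor `h` then cancels 1 - X.
    sum : t * E + X ^ r * Ê ≈ δ ^ r * F δ X r
    sum = begin
      t * E + X ^ r * Ê
        ≈⟨ *-identityʳ _ ⟨
      (t * E + X ^ r * Ê) * 1#
        ≈⟨ *-congˡ h-eq ⟨
      (t * E + X ^ r * Ê) * (h * (1# - X))
        ≈⟨ solve 4 (λ a b h y → (a :+ b) :* (h :* y) := h :* (a :* y :+ b :* y)) refl (t * E) (X ^ r * Ê) h (1# - X) ⟩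
      h * ((t * E) * (1# - X) + (X ^ r * Ê) * (1# - X))
        ≈⟨ *-congˡ (+-cong t-scaled Ê-scaled) ⟩
      h * (D * (p ^ r * (1# - p)) + D * ((X * u) ^ r * (1# - X * u)))
        ≈⟨ *-congˡ (distribˡ _ _ _) ⟨
      h * (D * (p ^ r * (1# - p) + (X * u) ^ r * (1# - X * u)))
        ≈⟨ *-congˡ (*-congˡ (power-differences p+q pq r)) ⟩
      h * (D * ((1# - X) * F δ X r))
        ≈⟨ solve 4 (λ h D y f → h :* (D :* (y :* f)) := (h :* y) :* (D :* f)) refl h D (1# - X) (F δ X r) ⟩
      (h * (1# - X)) * (D * F δ X r)
        ≈⟨ *-congʳ h-eq ⟩
      1# * (D * F δ X r)
        ≈⟨ *-identityˡ _ ⟩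
      D * F δ X r ∎
      where
      D = δ ^ r
      Ê-scaled : (X ^ r * Ê) * (1# - X) ≈ D * ((X * u) ^ r * (1# - X * u))
      Ê-scaled = begin
        (X ^ r * (D * (u ^ r * ((1# - X * u) * h)))) * (1# - X)
          ≈⟨ solve 6 (λ x D U w h y → (x :* (D :* (U :* (w :* h)))) :* y := D :* ((x :* U) :* (w :* (h :* y))))
               refl (X ^ r) D (u ^ r) (1# - X * u) h (1# - X) ⟩
        D * ((X ^ r * u ^ r) * ((1# - X * u) * (h * (1# - X))))
          ≈⟨ *-congˡ (*-cong (sym (^-distrib-* X u r)) (trans (*-congˡ h-eq) (*-identityʳ _))) ⟩
        D * ((X * u) ^ r * (1# - X * u)) ∎

-- The explicit solution as a power series, its recurrence and its linear coefficient

module Catalytic {c ℓ} (R : CommutativeRing c ℓ) (r : ℕ) where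
  open CommutativeRing R
  open PowerSeries R
  open import Algebra.Properties.Semiring.Exp semiring using (_^_)
  open import Algebra.Properties.Semiring.Mult semiring using (×-congʳ) renaming (_×_ to _·_)
  open import Algebra.Properties.Ring ring using (-0#≈0#; -‿distribˡ-*; +-inverseʳ-unique)
  open import Relation.Binary.Reasoning.Setoid setoid
  private
    module Q = CommutativeRing series
    module QS = IntegerSolver series
    module RS = IntegerSolver R
    module QR where open import Relation.Binary.Reasoning.Setoid Q.setoid public
  open Quadratic series using (2#; F; module Branches)
  open Quadratic R using (inverse-^)

  Deg≤-const : ∀ a → Deg≤ 0 (const a)
  Deg≤-const a (suc n) _ = refl

  Deg≤-X : Deg≤ 1 X
  Deg≤-X (suc zero)    (s≤s ())
  Deg≤-X (suc (suc n)) _ = refl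

  Deg≤-resp : ∀ {d f g} → f ≋ g → Deg≤ d f → Deg≤ d g
  Deg≤-resp fg df n d<n = trans (sym (fg n)) (df n d<n)

  Deg≤-mono : ∀ {d d' f} → d ℕ.≤ d' → Deg≤ d f → Deg≤ d' f
  Deg≤-mono d≤d' df n d'<n = df n (ℕₚ.≤-<-trans d≤d' d'<n)

  Deg≤-+ : ∀ {d f g} → Deg≤ d f → Deg≤ d g → Deg≤ d (f ⊞ g)
  Deg≤-+ df dg n d<n = trans (+-cong (df n d<n) (dg n d<n)) (+-identityˡ _)

  Deg≤-neg : ∀ {d f} → Deg≤ d f → Deg≤ d (⊟ f)
  Deg≤-neg df n d<n = trans (-‿cong (df n d<n)) -0#≈0#

  Deg≤-* : ∀ {d d' f g} → Deg≤ d f → Deg≤ d' g → Deg≤ (d ℕ.+ d') (f ✶ g)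
  Deg≤-* {d} {d'} {f} {g} df dg n d+d'<n =
    trans (conv-cong-antidiagonal n vanish) (conv-0 n (λ _ _ → 0#) (λ _ _ → refl))
    where
    vanish : ∀ i j → i ℕ.+ j ≡ n → f i * g j ≈ 0#
    vanish i j i+j≡n with d ℕ.<? i
    ... | yes d<i = trans (*-congʳ (df i d<i)) (zeroˡ _)
    ... | no d≮i  = trans (*-congˡ (dg j (ℕₚ.+-cancelˡ-< d d' j
      (ℕₚ.<-≤-trans d+d'<n (ℕₚ.≤-trans (ℕₚ.≤-reflexive (≡.sym i+j≡n)) (ℕₚ.+-monoˡ-≤ j (ℕₚ.≮⇒≥ d≮i))))))) (zeroʳ _)

  F-degree : ∀ δ n → Deg≤ n (F (const δ) X n)
  F-degree δ = go
    where
    2-δ : Deg≤ 0 (2# Q.- const δ)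
    2-δ = Deg≤-+ (Deg≤-+ (Deg≤-const 1#) (Deg≤-const 1#)) (Deg≤-neg (Deg≤-const δ))
    go : ∀ n → Deg≤ n (F (const δ) X n)
    go zero          = 2-δ
    go (suc zero)    = Deg≤-+ (Deg≤-mono z≤n (Deg≤-* (Deg≤-const δ) (Deg≤-+ (Deg≤-const 1#) (Deg≤-neg (Deg≤-const δ)))))
                              (Deg≤-* 2-δ (Deg≤-* 2-δ Deg≤-X))
    go (suc (suc n)) = Deg≤-+ (Deg≤-* (Deg≤-+ (Deg≤-mono z≤n (Deg≤-const δ)) (Deg≤-* 2-δ Deg≤-X)) (go (suc n)))
                              (Deg≤-neg (Deg≤-mono (ℕₚ.n≤1+n _) (Deg≤-* Deg≤-X (go n))))

  module Geometric (f : Series) where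
    open Fixpoint 1# (f ✶_) (λ n g g' gg → ✶-agree {f = f} (λ _ _ → refl) gg) public
      using () renaming (fix to geometric; fix-tail to geometric-tail; fix-equation to geometric-equation)

    geometric-inverse : geometric ✶ (Q.1# Q.- X ✶ f) ≋ Q.1#
    geometric-inverse = QR.begin
      geometric ✶ (Q.1# Q.- X ✶ f)
        QR.≈⟨ QS.solve 3 (λ g x f → g QS.:* (QS.one QS.:- x QS.:* f) QS.:= g QS.:- x QS.:* (f QS.:* g)) Q.refl geometric X f ⟩
      geometric Q.- X ✶ (f ✶ geometric)
        QR.≈⟨ Q.+-congʳ geometric-equation ⟩
      (Q.1# ⊞ X ✶ (f ✶ geometric)) Q.- X ✶ (f ✶ geometric)
        QR.≈⟨ QS.solve 1 (λ a → (QS.one QS.:+ a) QS.:- a QS.:= QS.one) Q.refl (X ✶ (f ✶ geometric)) ⟩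
      Q.1# QR.∎

  open Geometric public

  module Solution {t γ δ : Carrier} (γδ : γ * δ ≈ 1#) (γ-eq : γ ≈ 1# + t * (γ * (γ ^ r * γ ^ r))) where

    β : Series
    β = 2# Q.- const δ

    -- The condition p u = 1 with p = δ + β X - X u, multiplied by γ and solved for u, reads u = γ +
    -- X γ (u² - β u).
    Ψ : Series → Series
    Ψ f = const γ ✶ (f ✶ f Q.- β ✶ f)

    open Fixpoint γ Ψ
      (λ n f g fg → ✶-agree {f = const γ} (λ _ _ → refl)
        (λ k k<n → +-cong (✶-agree fg fg k k<n) (-‿cong (✶-agree {f = β} (λ _ _ → refl) fg k k<n))))
      using () renaming (fix to u; fix-equation to u-equation)

    p g h : Series
    p = (const δ ⊞ β ✶ X) Q.- X ✶ u
    g = geometric u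
    h = geometric Q.1#

    γδ' : const γ ✶ const δ ≋ Q.1#
    γδ' = Q.trans (Q.sym (const-* γ δ)) (const-cong γδ)

    γ-eq' : const γ ≋ Q.1# ⊞ const t ✶ (const γ ✶ ((const γ ^ˢ r) ✶ (const γ ^ˢ r)))
    γ-eq' = Q.trans (const-cong γ-eq) (Q.trans (const-+ 1# _) (Q.+-congˡ (Q.trans (const-* t _) (Q.*-congˡ {const t}
      (Q.trans (const-* γ _) (Q.*-congˡ {const γ} (Q.trans (const-* (γ ^ r) (γ ^ r))
        (Q.*-cong (const-^ γ r) (const-^ γ r)))))))))

    p+q : p ⊞ X ✶ u ≋ const δ ⊞ β ✶ X
    p+q = QS.solve 2 (λ e q → e QS.:- q QS.:+ q QS.:= e) Q.refl (const δ ⊞ β ✶ X) (X ✶ u)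

    pu : p ✶ u ≋ Q.1#
    pu = QR.begin
      p ✶ u
        QR.≈⟨ QS.solve 4 (λ d b x u → (d QS.:+ b QS.:* x QS.:- x QS.:* u) QS.:* u
               QS.:= d QS.:* u QS.:- x QS.:* (u QS.:* u QS.:- b QS.:* u)) Q.refl (const δ) β X u ⟩
      const δ ✶ u Q.- X ✶ W
        QR.≈⟨ Q.+-congʳ (Q.*-congˡ {const δ} u-equation) ⟩
      const δ ✶ (const γ ⊞ X ✶ (const γ ✶ W)) Q.- X ✶ W
        QR.≈⟨ QS.solve 4 (λ d c x w → d QS.:* (c QS.:+ x QS.:* (c QS.:* w)) QS.:- x QS.:* w
               QS.:= (c QS.:* d) QS.:* (QS.one QS.:+ x QS.:* w) QS.:- x QS.:* w) Q.refl (const δ) (const γ) X W ⟩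
      (const γ ✶ const δ) ✶ (Q.1# ⊞ X ✶ W) Q.- X ✶ W
        QR.≈⟨ Q.+-congʳ (Q.*-congʳ γδ') ⟩
      Q.1# ✶ (Q.1# ⊞ X ✶ W) Q.- X ✶ W
        QR.≈⟨ QS.solve 1 (λ a → QS.one QS.:* (QS.one QS.:+ a) QS.:- a QS.:= QS.one) Q.refl (X ✶ W) ⟩
      Q.1# QR.∎
      where
      W = u ✶ u Q.- β ✶ u

    h-inverse : h ✶ (Q.1# Q.- X) ≋ Q.1#
    h-inverse = Q.trans (Q.*-congˡ {h} (Q.+-congˡ (Q.-‿cong (Q.sym (Q.*-identityʳ X))))) (geometric-inverse Q.1#)

    open Branches r {const t} {const γ} {const δ} {X} {p} {u} {g} {h} γδ' γ-eq' p+q pu (geometric-inverse u) h-inverse public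
      using (E; Ê; product; sum)

    h-ones : ∀ k → h k ≈ 1#
    h-ones zero    = refl
    h-ones (suc k) = trans (geometric-tail Q.1# k) (trans (✶-identityˡ h k) (h-ones k))

    head-^ : ∀ f n → (f ^ˢ n) 0 ≈ f 0 ^ n
    head-^ f zero    = refl
    head-^ f (suc n) = *-congˡ (head-^ f n)

    X✶-head : ∀ f → (X ✶ f) 0 ≈ 0#
    X✶-head f = zeroˡ _

    1-Xu-head : (Q.1# Q.- X ✶ u) 0 ≈ 1#
    1-Xu-head = trans (+-congˡ (trans (-‿cong (X✶-head u)) -0#≈0#)) (+-identityʳ 1#)

    p-head : p 0 ≈ δ
    p-head = begin
      δ + (β 0 * 0#) - (0# * u 0)
        ≈⟨ RS.solve 3 (λ d b u → d RS.:+ b RS.:* RS.con (+ 0) RS.:- RS.con (+ 0) RS.:* u RS.:= d) refl δ (β 0) (u 0) ⟩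
      δ ∎

    Ê-head : Ê 0 ≈ 1#
    Ê-head = begin
      (const δ ^ˢ r) 0 * ((u ^ˢ r) 0 * ((Q.1# Q.- X ✶ u) 0 * 1#))
        ≈⟨ *-cong (head-^ (const δ) r) (*-cong (head-^ u r) (*-congʳ 1-Xu-head)) ⟩
      δ ^ r * (γ ^ r * (1# * 1#))
        ≈⟨ RS.solve 2 (λ d c → d RS.:* (c RS.:* (RS.one RS.:* RS.one)) RS.:= c RS.:* d) refl (δ ^ r) (γ ^ r) ⟩
      γ ^ r * δ ^ r
        ≈⟨ inverse-^ r γδ ⟩
      1# ∎

    E-head : E 0 ≈ 1#
    E-head = begin
      E 0              ≈⟨ *-identityˡ _ ⟨
      1# * E 0         ≈⟨ *-congʳ Ê-head ⟨
      Ê 0 * E 0        ≈⟨ product 0 ⟩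
      1#               ∎

    -- Above degree r the polynomial t E + Xʳ Ê vanishes.
    Ê-tail : ∀ m → Ê (suc m) ≈ - (t * E (suc r ℕ.+ m))
    Ê-tail m = +-inverseʳ-unique _ _ (begin
      t * E (suc r ℕ.+ m) + Ê (suc m)
        ≈⟨ +-cong (const-✶ t E (suc r ℕ.+ m)) (X^-✶ r Ê (suc m)) ⟨
      (const t ✶ E) (suc r ℕ.+ m) + ((X ^ˢ r) ✶ Ê) (r ℕ.+ suc m)
        ≈⟨ +-congˡ (reflexive (≡.cong ((X ^ˢ r) ✶ Ê) (ℕₚ.+-suc r m))) ⟩
      (const t ✶ E) (suc r ℕ.+ m) + ((X ^ˢ r) ✶ Ê) (suc r ℕ.+ m)
        ≈⟨ sum (suc r ℕ.+ m) ⟩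
      ((const δ ^ˢ r) ✶ F (const δ) X r) (suc r ℕ.+ m)
        ≈⟨ Deg≤-* (Deg≤-resp (const-^ δ r) (Deg≤-const (δ ^ r))) (F-degree δ r) (suc r ℕ.+ m) (s≤s (ℕₚ.m≤m+n r m)) ⟩
      0# ∎)

    -- Coefficient k + 1 of `product`: `Ê` starts with 1, its tail is - t times `E` shifted by r +
    -- 1, and every coefficient of `h` is 1.
    E-recurrence : ∀ k → E (suc k) ≈ 1# + t * conv (λ i j → E (suc r ℕ.+ i) * E j) k
    E-recurrence k = begin
      E (suc k)
        ≈⟨ RS.solve 2 (λ a b → a RS.:= RS.one RS.:* a RS.:- b RS.:+ b) refl (E (suc k)) (t * C) ⟩
      1# * E (suc k) - t * C + t * C
        ≈⟨ +-congʳ (+-cong (*-congʳ Ê-head) tail-product) ⟨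
      (Ê ✶ E) (suc k) + t * C
        ≈⟨ +-congʳ (trans (product (suc k)) (h-ones (suc k))) ⟩
      1# + t * C ∎
      where
      C = conv (λ i j → E (suc r ℕ.+ i) * E j) k
      tail-product : (tail Ê ✶ E) k ≈ - (t * C)
      tail-product = begin
        (tail Ê ✶ E) k
          ≈⟨ conv-cong k (λ i j → trans (*-congʳ (trans (Ê-tail i) (-‿distribˡ-* _ _))) (*-assoc _ _ _)) ⟩
        conv (λ i j → - t * (E (suc r ℕ.+ i) * E j)) k
          ≈⟨ conv-*ˡ k (- t) _ ⟩
        - t * C
          ≈⟨ -‿distribˡ-* t C ⟨
        - (t * C) ∎

    -- The logarithmic derivative of fⁿ at X = 0, with γ standing for 1 / f(0).
    linear-^ : ∀ f n → γ * f 0 ≈ 1# → γ ^ n * (f ^ˢ n) 1 ≈ n · (γ * f 1)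
    linear-^ f zero    γf = zeroʳ _
    linear-^ f (suc n) γf = begin
      γ * γ ^ n * (f 0 * (f ^ˢ n) 1 + f 1 * (f ^ˢ n) 0)
        ≈⟨ *-congˡ (+-congˡ (*-congˡ (head-^ f n))) ⟩
      γ * γ ^ n * (f 0 * (f ^ˢ n) 1 + f 1 * f 0 ^ n)
        ≈⟨ RS.solve 6 (λ c C a A b B → c RS.:* C RS.:* (a RS.:* A RS.:+ b RS.:* B)
             RS.:= (c RS.:* a) RS.:* (C RS.:* A) RS.:+ (C RS.:* B) RS.:* (c RS.:* b)) refl γ (γ ^ n) (f 0) ((f ^ˢ n) 1) (f 1) (f 0 ^ n) ⟩
      (γ * f 0) * (γ ^ n * (f ^ˢ n) 1) + (γ ^ n * f 0 ^ n) * (γ * f 1)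
        ≈⟨ +-cong (*-cong γf (linear-^ f n γf)) (*-congʳ (inverse-^ n γf)) ⟩
      1# * (n · (γ * f 1)) + 1# * (γ * f 1)
        ≈⟨ +-cong (*-identityˡ _) (*-identityˡ _) ⟩
      n · (γ * f 1) + γ * f 1
        ≈⟨ +-comm _ _ ⟩
      suc n · (γ * f 1) ∎

    γ-p-head : γ * p 0 ≈ 1#
    γ-p-head = trans (*-congˡ p-head) γδ

    -- The linear coefficient of p is (2 - δ) - γ because u starts with γ; the result is - (γ - 1)².
    γ-p-linear : γ * p 1 ≈ γ + γ - (1# + γ * γ)
    γ-p-linear = begin
      γ * (0# + (β 0 * 1# + β 1 * 0#) - (X ✶ u) 1)
        ≈⟨ *-congˡ (+-congˡ (-‿cong (X-✶ u 1))) ⟩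
      γ * (0# + ((1# + 1# - δ) * 1# + β 1 * 0#) - γ)
        ≈⟨ RS.solve 3 (λ c d z → c RS.:* (RS.con (+ 0) RS.:+ ((RS.one RS.:+ RS.one RS.:- d) RS.:* RS.one RS.:+ z RS.:* RS.con (+ 0)) RS.:- c)
             RS.:= c RS.:+ c RS.:- (c RS.:* d RS.:+ c RS.:* c)) refl γ δ (β 1) ⟩
      γ + γ - (γ * δ + γ * γ)
        ≈⟨ +-congˡ (-‿cong (+-congʳ γδ)) ⟩
      γ + γ - (1# + γ * γ) ∎

    E-one : E 1 ≈ γ + r · (γ + γ - (1# + γ * γ))
    E-one = begin
      ((const γ ^ˢ r) ✶ (p ^ˢ r ✶ g)) 1
        ≈⟨ ✶-cong {g = p ^ˢ r ✶ g} (Q.sym (const-^ γ r)) Q.refl 1 ⟩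
      (const (γ ^ r) ✶ (p ^ˢ r ✶ g)) 1
        ≈⟨ const-✶ (γ ^ r) (p ^ˢ r ✶ g) 1 ⟩
      γ ^ r * ((p ^ˢ r) 0 * g 1 + (p ^ˢ r) 1 * 1#)
        ≈⟨ *-congˡ (+-congʳ (*-cong (head-^ p r) (trans (geometric-tail u 0) (*-identityʳ _)))) ⟩
      γ ^ r * (p 0 ^ r * γ + (p ^ˢ r) 1 * 1#)
        ≈⟨ RS.solve 4 (λ G P c L → G RS.:* (P RS.:* c RS.:+ L RS.:* RS.one) RS.:= (G RS.:* P) RS.:* c RS.:+ G RS.:* L)
             refl (γ ^ r) (p 0 ^ r) γ ((p ^ˢ r) 1) ⟩
      (γ ^ r * p 0 ^ r) * γ + γ ^ r * (p ^ˢ r) 1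
        ≈⟨ +-cong (trans (*-congʳ (inverse-^ r γ-p-head)) (*-identityˡ γ)) (linear-^ p r γ-p-head) ⟩
      γ + r · (γ * p 1)
        ≈⟨ +-congˡ (×-congʳ r γ-p-linear) ⟩
      γ + r · (γ + γ - (1# + γ * γ)) ∎

open import Defs
open import Data.Bool using (true; false; if_then_else_)
open import Data.Empty using (⊥-elim)
open import Data.Fin as Fin using (Fin; zero; suc)
open import Data.List
  using (List; []; _∷_; _++_; [_]; length; map; concat; concatMap; lookup; applyUpTo; cartesianProduct; take; drop; replicate)
open import Data.List.Properties
  using (length-++; length-map; length-take; length-drop; length-replicate; take++drop≡id; ++-assoc; ++-identityʳ;
         concatMap-++; concat-++; map-cong-local; ∷-injective; ∷ʳ-injective)
open import Data.List.Membership.Propositional using (_∈_; _∉_)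
open import Data.List.Membership.Propositional.Properties
  using (∈-map⁺; ∈-map⁻; ∈-++⁺ˡ; ∈-++⁺ʳ; ∈-++⁻; ∈-insert; ∈-concat⁺′; ∈-concat⁻′; ∈-∃++; ∈-lookup;
         ∈-cartesianProduct⁺; ∈-cartesianProduct⁻)
open import Data.List.Relation.Binary.Disjoint.Propositional using (Disjoint)
open import Data.List.Relation.Unary.All as All using ([]; _∷_)
import Data.List.Relation.Unary.All.Properties as Allₚ
open import Data.List.Relation.Unary.AllPairs using ([]; _∷_)
open import Data.List.Relation.Unary.Any as Any using (here; there)
open import Data.List.Relation.Unary.Any.Properties using (lookup-index)
open import Data.List.Relation.Unary.Unique.Propositional using (Unique)
import Data.List.Relation.Unary.Unique.Propositional.Properties as Uniqueₚ
open import Data.Unit using (⊤; tt)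
open import Function.Bundles using (_⇔_; mk⇔)
open import Relation.Binary.PropositionalEquality
  using (refl; sym; trans; cong; cong₂; subst; module ≡-Reasoning)

-- Coefficients of γ and of the solution over the integers

module Coefficients (r : ℕ) where
  open PowerSeries ℤₚ.+-*-commutativeRing
  private
    module R = CommutativeRing series
    module RS = IntegerSolver series
    module RR where open import Relation.Binary.Reasoning.Setoid R.setoid public
  open IntegerSolver ℤₚ.+-*-commutativeRing
  open import Algebra.Properties.Semiring.Exp R.semiring using (^-homo-*)
  open import Algebra.Properties.Semiring.Mult R.semiring using () renaming (_×_ to _·_)

  open Catalytic ℤₚ.+-*-commutativeRing r using (geometric; geometric-inverse)

  -- `N` is the exponent in γ = 1 + t γᴺ. Written as suc (r + r), it makes γᴺ split into the factors
  -- γ, γʳ, γʳ of the fixpoint equation.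
  K N : ℕ
  K = r ℕ.+ r
  N = suc K

  open Fixpoint 1ℤ (λ f → f ✶ ((f ^ˢ r) ✶ (f ^ˢ r)))
    (λ n f g fg → ✶-agree {f = f} fg (✶-agree {f = f ^ˢ r} (^-causal r n f g fg) (^-causal r n f g fg)))
    using () renaming (fix to γ; fix-equation to γ-equation)

  -- γ has the form 1 - X (- W), so its inverse is a geometric series.
  δ : Series
  δ = geometric (⊟ (γ ✶ ((γ ^ˢ r) ✶ (γ ^ˢ r))))

  γδ : γ ✶ δ ≋ R.1#
  γδ = RR.begin
    γ ✶ δ               RR.≈⟨ R.*-congʳ {δ} γ-equation ⟩
    (R.1# ⊞ X ✶ W) ✶ δ  RR.≈⟨ RS.solve 3 (λ x w d → (RS.one RS.:+ x RS.:* w) RS.:* d RS.:= d RS.:* (RS.one RS.:- x RS.:* (RS.:- w))) R.refl X W δ ⟩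
    δ ✶ (R.1# R.- X ✶ (⊟ W)) RR.≈⟨ geometric-inverse (⊟ W) ⟩
    R.1# RR.∎
    where
    W = γ ✶ ((γ ^ˢ r) ✶ (γ ^ˢ r))

  private
    module C = Catalytic series r
    module Sol = C.Solution {X} {γ} {δ} γδ γ-equation
    module Q = PowerSeries series

  -- The solution is a series in y over series in t, so the inner `X` is t and the outer index is
  -- the exponent of y; hence the exchanged arguments.
  count : ℕ → ℕ → ℤ
  count n k = Sol.E k n

  conv-at : ∀ h k n → Q.conv h k n ≡ conv (λ i j → h i j n) k
  conv-at h zero    n = refl
  conv-at h (suc k) n = cong (λ z → h 0 (suc k) n ℤ.+ z) (conv-at (λ i j → h (suc i) j) k n)

  count-no-letters : ∀ k → count 0 k ≡ 1ℤ
  count-no-letters zero    = Sol.E-head 0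
  count-no-letters (suc k) = Sol.E-recurrence k 0

  count-no-words : ∀ n → count (suc n) 0 ≡ 0ℤ
  count-no-words n = Sol.E-head (suc n)

  count-recurrence : ∀ n k → count (suc n) (suc k)
    ≡ conv (λ i j → conv (λ a b → count a (suc r ℕ.+ i) ℤ.* count b j) n) k
  count-recurrence n k = begin
    count (suc n) (suc k)               ≡⟨ Sol.E-recurrence k (suc n) ⟩
    -- The summand 1 of `E-recurrence` contributes only to t⁰.
    0ℤ ℤ.+ (X ✶ Q.conv H k) (suc n)     ≡⟨ ℤₚ.+-identityˡ _ ⟩
    (X ✶ Q.conv H k) (suc n)            ≡⟨ X-✶ (Q.conv H k) (suc n) ⟩
    Q.conv H k n                        ≡⟨ conv-at H k n ⟩
    conv (λ i j → H i j n) k            ∎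
    where
    open ≡-Reasoning
    H = λ i j → Sol.E (suc r ℕ.+ i) ✶ Sol.E j

  γ^ : ℕ → ℕ → ℤ
  γ^ m n = (γ ^ˢ m) n

  -- The equation of γ times γᵐ. It carries the lexicographic induction of `γ^-closed`: either the
  -- exponent drops by one, or the order n drops while the exponent grows.
  γ^-expand : ∀ m → γ ^ˢ suc m ≋ (γ ^ˢ m) ⊞ X ✶ (γ ^ˢ (m ℕ.+ N))
  γ^-expand m = RR.begin
    γ ✶ (γ ^ˢ m)
      RR.≈⟨ R.*-congʳ {γ ^ˢ m} γ-equation ⟩
    (R.1# ⊞ X ✶ (γ ✶ ((γ ^ˢ r) ✶ (γ ^ˢ r)))) ✶ (γ ^ˢ m)
      RR.≈⟨ RS.solve 4 (λ x c G M → (RS.one RS.:+ x RS.:* (c RS.:* (G RS.:* G))) RS.:* M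
           RS.:= M RS.:+ x RS.:* (M RS.:* (c RS.:* (G RS.:* G)))) R.refl X γ (γ ^ˢ r) (γ ^ˢ m) ⟩
    (γ ^ˢ m) ⊞ X ✶ ((γ ^ˢ m) ✶ (γ ✶ ((γ ^ˢ r) ✶ (γ ^ˢ r))))
      RR.≈⟨ R.+-congˡ {γ ^ˢ m} (R.*-congˡ {X} (R.trans (^-homo-* γ m N) (R.*-congˡ {γ ^ˢ m} (R.*-congˡ {γ} (^-homo-* γ r r))))) ⟨
    (γ ^ˢ m) ⊞ X ✶ (γ ^ˢ (m ℕ.+ N)) RR.∎

  γ^-zero : ∀ m → γ^ m 0 ≡ 1ℤ
  γ^-zero zero    = refl
  γ^-zero (suc m) = trans (ℤₚ.*-identityˡ _) (γ^-zero m)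

  γ^-suc : ∀ m n → γ^ (suc m) (suc n) ≡ γ^ m (suc n) ℤ.+ γ^ (m ℕ.+ N) n
  γ^-suc m n = trans (γ^-expand m (suc n)) (cong (λ z → γ^ m (suc n) ℤ.+ z) (X-✶ (γ ^ˢ (m ℕ.+ N)) (suc n)))

  fac : ℕ → ℤ
  fac n = + (n !)

  fac-suc : ∀ n → fac (suc n) ≡ + suc n ℤ.* fac n
  fac-suc n = ℤₚ.pos-* (suc n) (n !)

  -- [tⁿ] γᵐ⁺¹ = (m + 1) / (N n + m + 1) · C(N n + m + 1 , n), cleared of denominators.
  γ^-closed : ∀ n m → γ^ (suc m) n ℤ.* (fac n ℤ.* fac (suc (K ℕ.* n ℕ.+ m))) ≡ + suc m ℤ.* fac (N ℕ.* n ℕ.+ m)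
  γ^-closed zero m
    rewrite γ^-zero (suc m) | ℕₚ.*-zeroʳ K = begin
    1ℤ ℤ.* (1ℤ ℤ.* fac (suc m))  ≡⟨ trans (ℤₚ.*-identityˡ _) (ℤₚ.*-identityˡ _) ⟩
    fac (suc m)                  ≡⟨ fac-suc m ⟩
    + suc m ℤ.* fac m            ∎
    where open ≡-Reasoning
  -- γ⁰ has no coefficient of positive order, so [tⁿ⁺¹] γ = [tⁿ] γᴺ, and N = K + 1 makes this the
  -- induction hypothesis at m = K.
  γ^-closed (suc n) zero = begin
    γ^ 1 (suc n) ℤ.* (fac (suc n) ℤ.* fac (suc (K ℕ.* suc n ℕ.+ 0)))
      ≡⟨ cong₂ ℤ._*_ first (cong₂ ℤ._*_ (fac-suc n) (cong (λ z → fac (suc z)) eqK)) ⟩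
    γ^ N n ℤ.* ((+ suc n ℤ.* fac n) ℤ.* fac (suc (K ℕ.* n ℕ.+ K)))
      ≡⟨ solve 4 (λ a s f g → a :* ((s :* f) :* g) := s :* (a :* (f :* g))) refl (γ^ N n) (+ suc n) (fac n) (fac (suc (K ℕ.* n ℕ.+ K))) ⟩
    + suc n ℤ.* (γ^ N n ℤ.* (fac n ℤ.* fac (suc (K ℕ.* n ℕ.+ K))))
      ≡⟨ cong (+ suc n ℤ.*_) (γ^-closed n K) ⟩
    + suc n ℤ.* (+ N ℤ.* T)
      ≡⟨ ℤₚ.*-assoc (+ suc n) (+ N) T ⟨
    (+ suc n ℤ.* + N) ℤ.* T
      ≡⟨ cong (ℤ._* T) (trans (sym (ℤₚ.pos-* (suc n) N)) (cong +_ (trans (ℕₚ.*-comm (suc n) N) eqN))) ⟩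
    + suc (N ℕ.* n ℕ.+ K) ℤ.* T
      ≡⟨ fac-suc (N ℕ.* n ℕ.+ K) ⟨
    fac (suc (N ℕ.* n ℕ.+ K))
      ≡⟨ cong fac (trans (sym eqN) (sym (ℕₚ.+-identityʳ _))) ⟩
    fac (N ℕ.* suc n ℕ.+ 0)
      ≡⟨ ℤₚ.*-identityˡ _ ⟨
    1ℤ ℤ.* fac (N ℕ.* suc n ℕ.+ 0) ∎
    where
    open ≡-Reasoning
    T = fac (N ℕ.* n ℕ.+ K)
    first : γ^ 1 (suc n) ≡ γ^ N n
    first = trans (γ^-suc 0 n) (ℤₚ.+-identityˡ (γ^ N n))
    eqK : K ℕ.* suc n ℕ.+ 0 ≡ K ℕ.* n ℕ.+ K
    eqK = trans (ℕₚ.+-identityʳ _) (trans (ℕₚ.*-suc K n) (ℕₚ.+-comm K _))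
    eqN : N ℕ.* suc n ≡ suc (N ℕ.* n ℕ.+ K)
    eqN = trans (ℕₚ.*-suc N n) (cong suc (ℕₚ.+-comm K _))
  γ^-closed (suc n) (suc m) = begin
    γ^ (suc (suc m)) (suc n) ℤ.* (fac (suc n) ℤ.* fac (suc (K ℕ.* suc n ℕ.+ suc m)))
      ≡⟨ cong₂ ℤ._*_ (γ^-suc (suc m) n) (cong₂ ℤ._*_ (fac-suc n)
           (trans (cong (λ z → fac (suc z)) (ℕₚ.+-suc (K ℕ.* suc n) m)) (fac-suc (suc d)))) ⟩
    (A ℤ.+ B) ℤ.* ((+ suc n ℤ.* fac n) ℤ.* (+ suc (suc d) ℤ.* G))
      ≡⟨ solve 6 (λ a b s f e g → (a :+ b) :* ((s :* f) :* (e :* g)) := e :* (a :* ((s :* f) :* g)) :+ s :* (b :* (f :* (e :* g))))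
           refl A B (+ suc n) (fac n) (+ suc (suc d)) G ⟩
    + suc (suc d) ℤ.* (A ℤ.* ((+ suc n ℤ.* fac n) ℤ.* G)) ℤ.+ + suc n ℤ.* (B ℤ.* (fac n ℤ.* (+ suc (suc d) ℤ.* G)))
      ≡⟨ cong₂ (λ x y → + suc (suc d) ℤ.* x ℤ.+ + suc n ℤ.* y)
           (trans (cong (λ z → A ℤ.* (z ℤ.* G)) (sym (fac-suc n))) (γ^-closed (suc n) m))
           (trans (cong (λ z → B ℤ.* (fac n ℤ.* z)) (trans (sym (fac-suc (suc d))) (cong (λ z → fac (suc z)) (sym eqK))))
             (trans (γ^-closed n (m ℕ.+ N)) (cong (λ z → + suc (m ℕ.+ N) ℤ.* fac z) eqN))) ⟩
    -- With s = n + 1 and N = K + 1, what remains is (K s + m + 2)(m + 1) + s (m + 1 + N) = (m +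
    -- 2)(N s + m + 1).
    + suc (suc d) ℤ.* (+ suc m ℤ.* T) ℤ.+ + suc n ℤ.* (+ suc (m ℕ.+ N) ℤ.* T)
      ≡⟨ cong (λ x → (+ 2 ℤ.+ (x ℤ.+ + m)) ℤ.* (+ suc m ℤ.* T) ℤ.+ + suc n ℤ.* (+ suc (m ℕ.+ N) ℤ.* T)) (ℤₚ.pos-* K (suc n)) ⟩
    (+ 2 ℤ.+ (+ K ℤ.* + suc n ℤ.+ + m)) ℤ.* (+ suc m ℤ.* T) ℤ.+ + suc n ℤ.* (+ suc (m ℕ.+ N) ℤ.* T)
      ≡⟨ solve 4 (λ k s m t →
           (con (+ 2) :+ (k :* s :+ m)) :* ((one :+ m) :* t) :+ s :* ((one :+ (m :+ (one :+ k))) :* t)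
           := (con (+ 2) :+ m) :* ((one :+ ((one :+ k) :* s :+ m)) :* t)) refl (+ K) (+ suc n) (+ m) T ⟩
    + suc (suc m) ℤ.* ((1ℤ ℤ.+ (+ N ℤ.* + suc n ℤ.+ + m)) ℤ.* T)
      ≡⟨ cong (λ x → + suc (suc m) ℤ.* ((1ℤ ℤ.+ (x ℤ.+ + m)) ℤ.* T)) (sym (ℤₚ.pos-* N (suc n))) ⟩
    + suc (suc m) ℤ.* (+ suc (N ℕ.* suc n ℕ.+ m) ℤ.* T)
      ≡⟨ cong (+ suc (suc m) ℤ.*_) (trans (sym (fac-suc (N ℕ.* suc n ℕ.+ m))) (cong fac (sym (ℕₚ.+-suc (N ℕ.* suc n) m)))) ⟩
    + suc (suc m) ℤ.* fac (N ℕ.* suc n ℕ.+ suc m) ∎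
    where
    open ≡-Reasoning
    d = K ℕ.* suc n ℕ.+ m
    A = γ^ (suc m) (suc n)
    B = γ^ (suc m ℕ.+ N) n
    G = fac (suc d)
    T = fac (N ℕ.* suc n ℕ.+ m)
    shift : ∀ M → M ℕ.* n ℕ.+ (m ℕ.+ M) ≡ M ℕ.* suc n ℕ.+ m
    shift M = begin
      M ℕ.* n ℕ.+ (m ℕ.+ M)  ≡⟨ ℕₚ.+-assoc (M ℕ.* n) m M ⟨
      M ℕ.* n ℕ.+ m ℕ.+ M    ≡⟨ ℕₚ.+-comm _ M ⟩
      M ℕ.+ (M ℕ.* n ℕ.+ m)  ≡⟨ ℕₚ.+-assoc M (M ℕ.* n) m ⟨
      M ℕ.+ M ℕ.* n ℕ.+ m    ≡⟨ cong (ℕ._+ m) (ℕₚ.*-suc M n) ⟨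
      M ℕ.* suc n ℕ.+ m      ∎
    eqN = shift N
    eqK : K ℕ.* n ℕ.+ (m ℕ.+ N) ≡ suc d
    eqK = trans (cong (K ℕ.* n ℕ.+_) (ℕₚ.+-suc m K)) (trans (ℕₚ.+-suc (K ℕ.* n) (m ℕ.+ K)) (cong suc (shift K)))

  ·-at : ∀ s f n → (s · f) n ≡ + s ℤ.* f n
  ·-at zero    f n = refl
  ·-at (suc s) f n = trans (cong (λ z → f n ℤ.+ z) (·-at s f n))
    (solve 2 (λ s x → x :+ s :* x := (one :+ s) :* x) refl (+ s) (f n))

  count-one : ∀ n → count (suc n) 1 ≡ γ^ 1 (suc n) ℤ.+ + r ℤ.* (γ^ 1 (suc n) ℤ.+ γ^ 1 (suc n) ℤ.- γ^ 2 (suc n))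
  count-one n = begin
    count (suc n) 1
      ≡⟨ Sol.E-one (suc n) ⟩
    γ (suc n) ℤ.+ (r · (γ ⊞ γ R.- (R.1# ⊞ γ ✶ γ))) (suc n)
      ≡⟨ cong (λ z → γ (suc n) ℤ.+ z) (·-at r _ (suc n)) ⟩
    γ (suc n) ℤ.+ + r ℤ.* (γ (suc n) ℤ.+ γ (suc n) ℤ.- (0ℤ ℤ.+ (γ ✶ γ) (suc n)))
      ≡⟨ cong₂ (λ x y → x ℤ.+ + r ℤ.* (x ℤ.+ x ℤ.- y)) (γ≋γ^1 (suc n))
           (trans (ℤₚ.+-identityˡ _) (R.*-congˡ {γ} γ≋γ^1 (suc n))) ⟩
    γ^ 1 (suc n) ℤ.+ + r ℤ.* (γ^ 1 (suc n) ℤ.+ γ^ 1 (suc n) ℤ.- γ^ 2 (suc n)) ∎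
    where
    open ≡-Reasoning
    γ≋γ^1 : γ ≋ γ ^ˢ 1
    γ≋γ^1 = R.sym (R.*-identityʳ γ)

  -- At positive order s the coefficient of γ - r (γ - 1)² is (2r + 1) [tˢ] γ - r [tˢ] γ². With
  -- denominators cleared, ((2r + 1) s)! gets the factor (2r + 1)(2r s + 2) - 2r ((2r + 1) s + 1) =
  -- 2 (r + 1).
  count-closed : ∀ n → count (suc n) 1 ℤ.* (fac (suc n) ℤ.* fac (2 ℕ.* r ℕ.* suc n ℕ.+ 2))
    ≡ + (2 ℕ.* (r ℕ.+ 1)) ℤ.* fac ((2 ℕ.* r ℕ.+ 1) ℕ.* suc n)
  count-closed n = begin
    count s 1 ℤ.* (f ℤ.* fac (2 ℕ.* r ℕ.* s ℕ.+ 2))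
      ≡⟨ cong₂ (λ x y → x ℤ.* (f ℤ.* y)) (count-one n) (trans (cong fac top) (fac-suc (suc (K ℕ.* s ℕ.+ 0)))) ⟩
    (a ℤ.+ + r ℤ.* (a ℤ.+ a ℤ.- b)) ℤ.* (f ℤ.* (e ℤ.* G))
      ≡⟨ solve 6 (λ a b r f e g → (a :+ r :* (a :+ a :- b)) :* (f :* (e :* g))
           := (one :+ (r :+ r)) :* e :* (a :* (f :* g)) :- r :* (b :* (f :* (e :* g)))) refl a b (+ r) f e G ⟩
    (+ N) ℤ.* e ℤ.* (a ℤ.* (f ℤ.* G)) ℤ.- + r ℤ.* (b ℤ.* (f ℤ.* (e ℤ.* G)))
      ≡⟨ cong₂ (λ x y → (+ N) ℤ.* e ℤ.* x ℤ.- + r ℤ.* y) (γ^-closed s 0)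
           (trans (cong (λ z → b ℤ.* (f ℤ.* z)) (trans (sym (fac-suc (suc (K ℕ.* s ℕ.+ 0)))) (cong (λ z → fac (suc z)) (sym (ℕₚ.+-suc (K ℕ.* s) 0)))))
             (trans (γ^-closed s 1) (cong (+ 2 ℤ.*_) (trans (cong fac (ℕₚ.+-suc (N ℕ.* s) 0)) (fac-suc (N ℕ.* s ℕ.+ 0)))))) ⟩
    (+ N) ℤ.* e ℤ.* (1ℤ ℤ.* T) ℤ.- + r ℤ.* (+ 2 ℤ.* (+ suc (N ℕ.* s ℕ.+ 0) ℤ.* T))
      ≡⟨ cong₂ (λ x y → (+ N) ℤ.* (+ 2 ℤ.+ (x ℤ.+ 0ℤ)) ℤ.* (1ℤ ℤ.* T) ℤ.- + r ℤ.* (+ 2 ℤ.* ((1ℤ ℤ.+ (y ℤ.+ 0ℤ)) ℤ.* T)))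
           (ℤₚ.pos-* K s) (ℤₚ.pos-* N s) ⟩
    (+ N) ℤ.* (+ 2 ℤ.+ (+ K ℤ.* + s ℤ.+ 0ℤ)) ℤ.* (1ℤ ℤ.* T) ℤ.- + r ℤ.* (+ 2 ℤ.* ((1ℤ ℤ.+ (+ N ℤ.* + s ℤ.+ 0ℤ)) ℤ.* T))
      ≡⟨ solve 3 (λ r s t → (one :+ (r :+ r)) :* (con (+ 2) :+ ((r :+ r) :* s :+ con 0ℤ)) :* (one :* t)
           :- r :* (con (+ 2) :* ((one :+ ((one :+ (r :+ r)) :* s :+ con 0ℤ)) :* t))
           := (con (+ 2) :* (r :+ one)) :* t) refl (+ r) (+ s) T ⟩
    (+ 2 ℤ.* (+ r ℤ.+ 1ℤ)) ℤ.* T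
      ≡⟨ cong₂ ℤ._*_ (sym (ℤₚ.pos-* 2 (r ℕ.+ 1))) (cong fac bottom) ⟩
    + (2 ℕ.* (r ℕ.+ 1)) ℤ.* fac ((2 ℕ.* r ℕ.+ 1) ℕ.* s) ∎
    where
    open ≡-Reasoning
    s = suc n
    a = γ^ 1 s
    b = γ^ 2 s
    f = fac s
    e = + suc (suc (K ℕ.* s ℕ.+ 0))
    G = fac (suc (K ℕ.* s ℕ.+ 0))
    T = fac (N ℕ.* s ℕ.+ 0)
    2r : 2 ℕ.* r ≡ K
    2r = cong (r ℕ.+_) (ℕₚ.+-identityʳ r)
    top : 2 ℕ.* r ℕ.* s ℕ.+ 2 ≡ suc (suc (K ℕ.* s ℕ.+ 0))
    top = trans (cong (λ z → z ℕ.* s ℕ.+ 2) 2r) (trans (ℕₚ.+-suc _ 1) (cong suc (ℕₚ.+-suc _ 0)))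
    bottom : N ℕ.* s ℕ.+ 0 ≡ (2 ℕ.* r ℕ.+ 1) ℕ.* s
    bottom = trans (ℕₚ.+-identityʳ _) (cong (ℕ._* s) (trans (cong suc (sym 2r)) (ℕₚ.+-comm 1 (2 ℕ.* r))))

open PowerSeries ℤₚ.+-*-commutativeRing using (conv)

-- Enumerations

-- The size is an integer because the counts arise as coefficients of series over ℤ, where
-- subtraction was essential; `cast-count` leads back to ℕ.
record Enumeration {A : Set} (P : A → Set) (z : ℤ) : Set where
  field
    list     : List A
    unique   : Unique list
    sound    : ∀ {x} → x ∈ list → P x
    complete : ∀ {x} → P x → x ∈ list
    size     : + length list ≡ z

open Enumeration

module _ {A : Set} where
  enum-none : {P : A → Set} → (∀ x → ¬ P x) → Enumeration P 0ℤ
  enum-none ¬P = record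
    { list = [] ; unique = [] ; sound = λ () ; complete = λ Px → ⊥-elim (¬P _ Px) ; size = refl }

  enum-one : {P : A → Set} (x : A) → P x → (∀ {y} → P y → y ≡ x) → Enumeration P 1ℤ
  enum-one x Px only = record
    { list = [ x ] ; unique = [] ∷ [] ; sound = λ { (here refl) → Px } ; complete = λ Py → here (only Py) ; size = refl }

  enum-⊎ : {P Q R : A → Set} {z w : ℤ} → Enumeration P z → Enumeration Q w →
           (∀ {x} → P x → R x) → (∀ {x} → Q x → R x) → (∀ {x} → R x → P x ⊎ Q x) →
           (∀ {x} → P x → ¬ Q x) → Enumeration R (z ℤ.+ w)
  enum-⊎ p q P⇒R Q⇒R R⇒P⊎Q disjoint = record
    { list     = list p ++ list q
    ; unique   = Uniqueₚ.++⁺ (unique p) (unique q) (λ (x∈p , x∈q) → disjoint (sound p x∈p) (sound q x∈q))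
    ; sound    = λ x∈ → [ P⇒R ∘ sound p , Q⇒R ∘ sound q ]′ (∈-++⁻ (list p) x∈)
    ; complete = λ Rx → [ ∈-++⁺ˡ ∘ complete p , ∈-++⁺ʳ (list p) ∘ complete q ]′ (R⇒P⊎Q Rx)
    ; size     = trans (cong +_ (length-++ (list p))) (cong₂ ℤ._+_ (size p) (size q)) }

length-cartesianProduct : {A B : Set} (xs : List A) (ys : List B) →
                          length (cartesianProduct xs ys) ≡ length xs ℕ.* length ys
length-cartesianProduct []       ys = refl
length-cartesianProduct (x ∷ xs) ys =
  trans (length-++ (map (x ,_) ys)) (cong₂ ℕ._+_ (length-map (x ,_) ys) (length-cartesianProduct xs ys))

module _ {A B : Set} where
  map-unique : (f : A → B) (xs : List A) → (∀ {x y} → x ∈ xs → y ∈ xs → f x ≡ f y → x ≡ y) →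
               Unique xs → Unique (map f xs)
  map-unique f []       inj []         = []
  map-unique f (x ∷ xs) inj (x≢ ∷ uxs) =
    Allₚ.map⁺ (All.tabulate λ y∈ fx≡fy → All.lookup x≢ y∈ (inj (here refl) (there y∈) fx≡fy))
    ∷ map-unique f xs (λ x∈ y∈ → inj (there x∈) (there y∈)) uxs

  -- Injectivity is asked only on `P`: `concat`, for instance, is injective on one-word lists but
  -- not on all lists.
  enum-map : {P : A → Set} {Q : B → Set} {z : ℤ} (f : A → B) → Enumeration P z →
             (∀ {x} → P x → Q (f x)) → (∀ {y} → Q y → ∃[ x ] P x × y ≡ f x) →
             (∀ {x y} → P x → P y → f x ≡ f y → x ≡ y) → Enumeration Q z
  enum-map {Q = Q} f p P⇒Q Q⇒P inj = record
    { list     = map f (list p)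
    ; unique   = map-unique f (list p) (λ x∈ y∈ → inj (sound p x∈) (sound p y∈)) (unique p)
    ; sound    = λ y∈ → let x , x∈ , y≡fx = ∈-map⁻ f y∈ in subst Q (sym y≡fx) (P⇒Q (sound p x∈))
    ; complete = λ Qy → let x , Px , y≡fx = Q⇒P Qy in subst (_∈ map f (list p)) (sym y≡fx) (∈-map⁺ f (complete p Px))
    ; size     = trans (cong +_ (length-map f (list p))) (size p) }

  enum-× : {P : A → Set} {Q : B → Set} {z w : ℤ} → Enumeration P z → Enumeration Q w →
           Enumeration (λ (x , y) → P x × Q y) (z ℤ.* w)
  enum-× p q = record
    { list     = cartesianProduct (list p) (list q)
    ; unique   = Uniqueₚ.cartesianProduct⁺ (unique p) (unique q)
    ; sound    = λ xy∈ → let x∈ , y∈ = ∈-cartesianProduct⁻ (list p) (list q) xy∈ in sound p x∈ , sound q y∈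
    ; complete = λ (Px , Qy) → ∈-cartesianProduct⁺ (complete p Px) (complete q Qy)
    ; size     = trans (cong +_ (length-cartesianProduct (list p) (list q)))
                   (trans (ℤₚ.pos-* (length (list p)) (length (list q))) (cong₂ ℤ._*_ (size p) (size q))) }

-- Only i is stored, since i + j ≡ k determines j; the stored index keeps the summands apart.
Antidiagonal : {A : Set} → (ℕ → ℕ → A → Set) → ℕ → ℕ × A → Set
Antidiagonal P k (i , x) = ∃[ j ] i ℕ.+ j ≡ k × P i j x

-- Mirrors the recursion of `conv`: the elements with index 0, then the others with their index
-- lowered by one.
enum-conv : {A : Set} (P : ℕ → ℕ → A → Set) (c : ℕ → ℕ → ℤ) (k : ℕ) →
            (∀ i j → i ℕ.+ j ≡ k → Enumeration (P i j) (c i j)) →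
            Enumeration (Antidiagonal P k) (conv c k)
enum-conv P c zero    e = enum-map (0 ,_) (e 0 0 refl) (λ Px → 0 , refl , Px)
  (λ { {zero , x} (zero , refl , Px) → x , Px , refl }) (λ _ _ → cong proj₂)
enum-conv P c (suc k) e = enum-⊎
  (enum-map {Q = λ (i , x) → i ≡ 0 × P 0 (suc k) x} (0 ,_) (e 0 (suc k) refl) (λ Px → refl , Px)
    (λ { {_ , x} (refl , Px) → x , Px , refl }) (λ _ _ → cong proj₂))
  (enum-map {Q = λ (i , x) → 0 ℕ.< i × Antidiagonal P (suc k) (i , x)} (λ (i , x) → suc i , x)
    (enum-conv (λ i → P (suc i)) (λ i → c (suc i)) k (λ i j i+j≡k → e (suc i) j (cong suc i+j≡k)))
    (λ (j , i+j≡k , Px) → ℕ.s≤s ℕ.z≤n , j , cong suc i+j≡k , Px)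
    (λ { {suc i , x} (_ , j , i+j≡k , Px) → (i , x) , (j , ℕₚ.suc-injective i+j≡k , Px) , refl })
    (λ { _ _ refl → refl }))
  (λ { {_ , x} (refl , Px) → suc k , refl , Px })
  proj₂
  (λ { {zero , x} (j , refl , Px) → inj₁ (refl , Px) ; {suc i , x} R → inj₂ (ℕ.s≤s ℕ.z≤n , R) })
  (λ { (refl , _) (() , _) })

-- Words and stack sorting

Word : Set
Word = List ℕ

≡ᵇ-refl : ∀ m → (m ≡ᵇ m) ≡ true
≡ᵇ-refl m = dec-true (m ℕ.≟ m) refl

≢⇒≡ᵇ : ∀ x m → x ≢ m → (x ≡ᵇ m) ≡ false
≢⇒≡ᵇ x m = dec-false (x ℕ.≟ m)

occ-++ : ∀ a u v → occ a (u ++ v) ≡ occ a u ℕ.+ occ a v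
occ-++ a []      v = refl
occ-++ a (x ∷ u) v = trans (cong (b ℕ.+_) (occ-++ a u v)) (sym (ℕₚ.+-assoc b (occ a u) (occ a v)))
  where b = if x ≡ᵇ a then 1 else 0

occ-∷-≡ : ∀ a w → occ a (a ∷ w) ≡ suc (occ a w)
occ-∷-≡ a w rewrite ≡ᵇ-refl a = refl

occ-∷-≢ : ∀ a x w → x ≢ a → occ a (x ∷ w) ≡ occ a w
occ-∷-≢ a x w x≢a rewrite ≢⇒≡ᵇ x a x≢a = refl

occ-∉ : ∀ {a} w → a ∉ w → occ a w ≡ 0
occ-∉ []      a∉w = refl
occ-∉ {a} (x ∷ w) a∉w = trans (occ-∷-≢ a x w (λ { refl → a∉w (here refl) })) (occ-∉ w (a∉w ∘ there))

occ-∈ : ∀ {a} w → 1 ≤ occ a w → a ∈ w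
occ-∈ {a} (x ∷ w) 1≤ with x ℕ.≟ a
... | yes refl = here refl
... | no x≢a   = there (occ-∈ w (subst (1 ≤_) (occ-∷-≢ a x w x≢a) 1≤))

-- Inverse to `splitOn m` on blocks without m. The first block is a separate argument because
-- splitting always yields at least one block.
join : ℕ → Word → List Word → Word
join m α []       = α
join m α (β ∷ βs) = α ++ m ∷ join m β βs

sep-∈ : ∀ m α β βs → m ∈ join m α (β ∷ βs)
sep-∈ m α β βs = ∈-insert α

∈-join⁺ : ∀ {x m} α αs → x ∈ concat (α ∷ αs) → x ∈ join m α αs
∈-join⁺ α []       x∈ = subst (_ ∈_) (++-identityʳ α) x∈
∈-join⁺ α (β ∷ βs) x∈ = [ ∈-++⁺ˡ , ∈-++⁺ʳ α ∘ there ∘ ∈-join⁺ β βs ]′ (∈-++⁻ α x∈)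

∈-join⁻ : ∀ {x m} α αs → x ∈ join m α αs → x ≡ m ⊎ x ∈ concat (α ∷ αs)
∈-join⁻ α []       x∈ = inj₂ (∈-++⁺ˡ x∈)
∈-join⁻ α (β ∷ βs) x∈ with ∈-++⁻ α x∈
... | inj₁ x∈α         = inj₂ (∈-++⁺ˡ x∈α)
... | inj₂ (here x≡m)  = inj₁ x≡m
... | inj₂ (there x∈′) = [ inj₁ , inj₂ ∘ ∈-++⁺ʳ α ]′ (∈-join⁻ β βs x∈′)

occ-join : ∀ {a m} α αs → m ≢ a → occ a (join m α αs) ≡ occ a (concat (α ∷ αs))
occ-join α []       m≢a = cong (occ _) (sym (++-identityʳ α))
occ-join {a} {m} α (β ∷ βs) m≢a = begin
  occ a (α ++ m ∷ join m β βs)            ≡⟨ occ-++ a α (m ∷ join m β βs) ⟩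
  occ a α ℕ.+ occ a (m ∷ join m β βs)     ≡⟨ cong (occ a α ℕ.+_) (trans (occ-∷-≢ a m (join m β βs) m≢a) (occ-join β βs m≢a)) ⟩
  occ a α ℕ.+ occ a (concat (β ∷ βs))     ≡⟨ occ-++ a α (concat (β ∷ βs)) ⟨
  occ a (concat (α ∷ β ∷ βs))             ∎
  where open ≡-Reasoning

occ-sep : ∀ {m} α αs → m ∉ concat (α ∷ αs) → occ m (join m α αs) ≡ length αs
occ-sep α []       m∉ = occ-∉ α (m∉ ∘ ∈-++⁺ˡ)
occ-sep {m} α (β ∷ βs) m∉ = begin
  occ m (α ++ m ∷ join m β βs)            ≡⟨ occ-++ m α (m ∷ join m β βs) ⟩
  occ m α ℕ.+ occ m (m ∷ join m β βs)     ≡⟨ cong₂ ℕ._+_ (occ-∉ α (m∉ ∘ ∈-++⁺ˡ)) (occ-∷-≡ m (join m β βs)) ⟩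
  suc (occ m (join m β βs))               ≡⟨ cong suc (occ-sep β βs (m∉ ∘ ∈-++⁺ʳ α)) ⟩
  suc (length βs)                         ∎
  where open ≡-Reasoning

splitOn-∷ : ∀ m x w {β βs} → splitOn m w ≡ β ∷ βs →
            splitOn m (x ∷ w) ≡ (if x ≡ᵇ m then [] ∷ β ∷ βs else (x ∷ β) ∷ βs)
splitOn-∷ m x w eq rewrite eq = refl

splitOn-++ : ∀ m α w {β βs} → m ∉ α → splitOn m w ≡ β ∷ βs → splitOn m (α ++ w) ≡ (α ++ β) ∷ βs
splitOn-++ m []      w m∉ eq = eq
splitOn-++ m (x ∷ α) w {β} {βs} m∉ eq =
  trans (splitOn-∷ m x (α ++ w) (splitOn-++ m α w (m∉ ∘ there) eq))
        (cong (λ b → if b then [] ∷ (α ++ β) ∷ βs else (x ∷ α ++ β) ∷ βs) (≢⇒≡ᵇ x m (λ { refl → m∉ (here refl) })))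

splitOn-join : ∀ m α αs → m ∉ concat (α ∷ αs) → splitOn m (join m α αs) ≡ α ∷ αs
splitOn-join m α [] m∉ = begin
  splitOn m α          ≡⟨ cong (splitOn m) (++-identityʳ α) ⟨
  splitOn m (α ++ [])  ≡⟨ splitOn-++ m α [] (m∉ ∘ ∈-++⁺ˡ) refl ⟩
  (α ++ []) ∷ []       ≡⟨ cong (_∷ []) (++-identityʳ α) ⟩
  α ∷ []               ∎
  where open ≡-Reasoning
splitOn-join m α (β ∷ βs) m∉ = begin
  splitOn m (α ++ m ∷ join m β βs)  ≡⟨ splitOn-++ m α _ (m∉ ∘ ∈-++⁺ˡ) at-sep ⟩
  (α ++ []) ∷ β ∷ βs                ≡⟨ cong (_∷ β ∷ βs) (++-identityʳ α) ⟩
  α ∷ β ∷ βs                        ∎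
  where
  open ≡-Reasoning
  at-sep : splitOn m (m ∷ join m β βs) ≡ [] ∷ β ∷ βs
  at-sep = trans (splitOn-∷ m m (join m β βs) (splitOn-join m β βs (m∉ ∘ ∈-++⁺ʳ α)))
                 (cong (λ b → if b then [] ∷ β ∷ βs else (m ∷ β) ∷ βs) (≡ᵇ-refl m))

-- Together with `splitOn-join`, this turns later case analyses of `splitOn` into matching on
-- `join`.
unjoin : ∀ m w → ∃[ α ] ∃[ αs ] w ≡ join m α αs × m ∉ concat (α ∷ αs)
unjoin m []      = [] , [] , refl , λ ()
unjoin m (x ∷ w) with x ℕ.≟ m | unjoin m w
... | yes refl | α , αs , refl , m∉ = [] , α ∷ αs , refl , m∉
... | no x≢m | α , [] , refl , m∉ = x ∷ α , [] , refl , λ { (here refl) → x≢m refl ; (there m∈) → m∉ m∈ }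
... | no x≢m | α , β ∷ βs , refl , m∉ = x ∷ α , β ∷ βs , refl , λ { (here refl) → x≢m refl ; (there m∈) → m∉ m∈ }

∈⇒≤maxL : ∀ {x} w → x ∈ w → x ≤ maxL w
∈⇒≤maxL (y ∷ w) (here refl) = ℕₚ.m≤m⊔n y (maxL w)
∈⇒≤maxL (y ∷ w) (there x∈)  = ℕₚ.≤-trans (∈⇒≤maxL w x∈) (ℕₚ.m≤n⊔m y (maxL w))

maxL-∈ : ∀ x w → maxL (x ∷ w) ∈ x ∷ w
maxL-∈ x []      = here (ℕₚ.⊔-identityʳ x)
maxL-∈ x (y ∷ w) with ℕₚ.⊔-sel x (maxL (y ∷ w))
... | inj₁ eq = here eq
... | inj₂ eq = there (subst (_∈ y ∷ w) (sym eq) (maxL-∈ y w))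

maxL-≡ : ∀ {m} w → m ∈ w → (∀ {x} → x ∈ w → x ≤ m) → maxL w ≡ m
maxL-≡ (x ∷ w) m∈ ≤m = ℕₚ.≤-antisym (≤m (maxL-∈ x w)) (∈⇒≤maxL (x ∷ w) m∈)

length-join-≥ : ∀ m {β} α αs → β ∈ α ∷ αs → length β ≤ length (join m α αs)
length-join-> : ∀ m {δ} α β βs → δ ∈ α ∷ β ∷ βs → length δ < length (join m α (β ∷ βs))

length-join-≥ m α []       (here refl) = ℕₚ.≤-refl
length-join-≥ m α (β ∷ βs) δ∈          = ℕₚ.<⇒≤ (length-join-> m α β βs δ∈)

length-join-> m {δ} α β βs δ∈ = subst (length δ <_) (sym (length-++ α)) (bound δ∈)
  where
  bound : δ ∈ α ∷ β ∷ βs → length δ < length α ℕ.+ suc (length (join m β βs))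
  bound (here refl) = ℕₚ.m<m+n (length α) (s≤s z≤n)
  bound (there δ∈′) = ℕₚ.≤-trans (s≤s (length-join-≥ m β βs δ∈′)) (ℕₚ.m≤n+m _ (length α))

length-block-< : ∀ m {β} w → m ∈ w → β ∈ splitOn m w → length β < length w
length-block-< m {β} w m∈ β∈ with unjoin m w
... | α , [] , refl , m∉ = ⊥-elim (m∉ (∈-++⁺ˡ m∈))
... | α , γ ∷ γs , refl , m∉ = length-join-> m α γ γs (subst (β ∈_) (splitOn-join m α (γ ∷ γs) m∉) β∈)

length-block-≤ : ∀ x w {k β} → length w ≤ k → β ∈ splitOn (maxL (x ∷ w)) (x ∷ w) → length β ≤ k
length-block-≤ x w ≤k β∈ = ℕₚ.≤-trans (ℕₚ.≤-pred (length-block-< _ (x ∷ w) (maxL-∈ x w) β∈)) ≤k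

concatMap-cong-∈ : {f g : Word → Word} (ws : List Word) → (∀ {w} → w ∈ ws → f w ≡ g w) → concatMap f ws ≡ concatMap g ws
concatMap-cong-∈ ws eq = cong concat (map-cong-local (All.tabulate eq))

Sf-fuel : ∀ k l w → length w ≤ k → length w ≤ l → Sf k w ≡ Sf l w
Sf-fuel zero    zero    []      _ _ = refl
Sf-fuel zero    (suc l) []      _ _ = refl
Sf-fuel (suc k) zero    []      _ _ = refl
Sf-fuel (suc k) (suc l) []      _ _ = refl
Sf-fuel (suc k) (suc l) (x ∷ w) (s≤s w≤k) (s≤s w≤l) = cong (_++ [ maxL (x ∷ w) ])
  (concatMap-cong-∈ (splitOn (maxL (x ∷ w)) (x ∷ w))
    (λ {β} β∈ → Sf-fuel k l β (length-block-≤ x w w≤k β∈) (length-block-≤ x w w≤l β∈)))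

S-unfold : ∀ x w → S (x ∷ w) ≡ concatMap S (splitOn (maxL (x ∷ w)) (x ∷ w)) ++ [ maxL (x ∷ w) ]
S-unfold x w = cong (_++ [ maxL (x ∷ w) ]) (concatMap-cong-∈ (splitOn (maxL (x ∷ w)) (x ∷ w))
  (λ {β} β∈ → Sf-fuel (length w) (length β) β (length-block-≤ x w ℕₚ.≤-refl β∈) ℕₚ.≤-refl))

S-max : ∀ {m} w → m ∈ w → (∀ {x} → x ∈ w → x ≤ m) → S w ≡ concatMap S (splitOn m w) ++ [ m ]
S-max (x ∷ w) m∈ ≤m = trans (S-unfold x w) (cong (λ k → concatMap S (splitOn k (x ∷ w)) ++ [ k ]) (maxL-≡ (x ∷ w) m∈ ≤m))

-- Two leading blocks guarantee an occurrence of m. The number of blocks is left free so that both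
-- passes are covered: r + 1 blocks in the first, two in the second, where m occurs once.
S-join : ∀ m α β βs → (∀ {x} → x ∈ concat (α ∷ β ∷ βs) → x < m) →
         S (join m α (β ∷ βs)) ≡ concatMap S (α ∷ β ∷ βs) ++ [ m ]
S-join m α β βs <m = trans
  (S-max (join m α (β ∷ βs)) (sep-∈ m α β βs)
    (λ x∈ → [ ℕₚ.≤-reflexive , ℕₚ.<⇒≤ ∘ <m ]′ (∈-join⁻ α (β ∷ βs) x∈)))
  (cong (λ bs → concatMap S bs ++ [ m ]) (splitOn-join m α (β ∷ βs) (ℕₚ.<-irrefl refl ∘ <m)))

∈-concatMap-cong : ∀ {x} (f g : Word → Word) ws → (∀ {w} → w ∈ ws → x ∈ f w → x ∈ g w) →
                   x ∈ concatMap f ws → x ∈ concatMap g ws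
∈-concatMap-cong f g ws imp x∈ with ∈-concat⁻′ (map f ws) x∈
... | v , x∈v , v∈ with ∈-map⁻ f v∈
...   | w , w∈ , refl = ∈-concat⁺′ (imp w∈ x∈v) (∈-map⁺ g w∈)

concatMap-id : (ws : List Word) → concatMap (λ w → w) ws ≡ concat ws
concatMap-id []       = refl
concatMap-id (w ∷ ws) = cong (w ++_) (concatMap-id ws)

∈-blocks⁻ : ∀ {x} m w → x ∈ concat (splitOn m w) → x ∈ w
∈-blocks⁻ m w x∈ with unjoin m w
... | α , αs , refl , m∉ = ∈-join⁺ α αs (subst (λ bs → _ ∈ concat bs) (splitOn-join m α αs m∉) x∈)

∈-blocks⁺ : ∀ {x} m w → x ∈ w → x ≡ m ⊎ x ∈ concat (splitOn m w)
∈-blocks⁺ m w x∈ with unjoin m w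
... | α , αs , refl , m∉ = [ inj₁ , inj₂ ∘ subst (λ bs → _ ∈ concat bs) (sym (splitOn-join m α αs m∉)) ]′ (∈-join⁻ α αs x∈)

-- Stack sorting merges the copies of the maximum into one, so it preserves the set of letters but
-- not their multiplicities; membership is what can be carried through it.
∈-Sf⁻ : ∀ {x} k w → x ∈ Sf k w → x ∈ w
∈-Sf⁻ (suc k) (y ∷ w) x∈ with ∈-++⁻ (concatMap (Sf k) (splitOn (maxL (y ∷ w)) (y ∷ w))) x∈
... | inj₁ x∈bs = ∈-blocks⁻ (maxL (y ∷ w)) (y ∷ w) (subst (_ ∈_) (concatMap-id (splitOn (maxL (y ∷ w)) (y ∷ w)))
    (∈-concatMap-cong (Sf k) (λ v → v) (splitOn (maxL (y ∷ w)) (y ∷ w)) (λ {v} _ → ∈-Sf⁻ k v) x∈bs))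
... | inj₂ (here refl) = maxL-∈ y w

∈-Sf⁺ : ∀ {x} k w → length w ≤ k → x ∈ w → x ∈ Sf k w
∈-Sf⁺ (suc k) (y ∷ w) (s≤s w≤k) x∈ with ∈-blocks⁺ (maxL (y ∷ w)) (y ∷ w) x∈
... | inj₁ refl = ∈-++⁺ʳ (concatMap (Sf k) (splitOn (maxL (y ∷ w)) (y ∷ w))) (here refl)
... | inj₂ x∈bs = ∈-++⁺ˡ (∈-concatMap-cong (λ v → v) (Sf k) (splitOn (maxL (y ∷ w)) (y ∷ w))
    (λ {v} v∈ → ∈-Sf⁺ k v (length-block-≤ y w w≤k v∈))
    (subst (_ ∈_) (sym (concatMap-id (splitOn (maxL (y ∷ w)) (y ∷ w)))) x∈bs))

SS : List Word → Word
SS ws = S (concatMap S ws)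

∈-concatMap-S⁻ : ∀ {x} ws → x ∈ concatMap S ws → x ∈ concat ws
∈-concatMap-S⁻ ws x∈ = subst (_ ∈_) (concatMap-id ws) (∈-concatMap-cong S (λ v → v) ws (λ {v} _ → ∈-Sf⁻ (length v) v) x∈)

∈-concatMap-S⁺ : ∀ {x} ws → x ∈ concat ws → x ∈ concatMap S ws
∈-concatMap-S⁺ ws x∈ =
  ∈-concatMap-cong (λ v → v) S ws (λ {v} _ → ∈-Sf⁺ (length v) v ℕₚ.≤-refl) (subst (_ ∈_) (sym (concatMap-id ws)) x∈)

∈-SS⁺ : ∀ {x} ws → x ∈ concat ws → x ∈ SS ws
∈-SS⁺ ws x∈ = ∈-Sf⁺ (length (concatMap S ws)) (concatMap S ws) ℕₚ.≤-refl (∈-concatMap-S⁺ ws x∈)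

-- The nesting condition

-- The letters of w that precede the last occurrence of a are at most a.
Cov : ℕ → Word → Set
Cov a []      = ⊤
Cov a (c ∷ w) = (a ∈ w → c ≤ a) × Cov a w

-- The condition on positions i < j < k in `IsRPerm`, put in a form recursive in the word so that it
-- can be followed through `++` and `join`.
Nest : Word → Set
Nest []      = ⊤
Nest (a ∷ w) = Cov a w × Nest w

Cov-bounded : ∀ a w → (∀ {c} → c ∈ w → c ≤ a) → Cov a w
Cov-bounded a []      ≤a = tt
Cov-bounded a (c ∷ w) ≤a = (λ _ → ≤a (here refl)) , Cov-bounded a w (≤a ∘ there)

Cov-∉ : ∀ {a} w → a ∉ w → Cov a w
Cov-∉ []      a∉ = tt
Cov-∉ (c ∷ w) a∉ = (λ a∈ → ⊥-elim (a∉ (there a∈))) , Cov-∉ w (a∉ ∘ there)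

Cov-++⁺ : ∀ {a} u v → a ∉ v → Cov a u → Cov a (u ++ v)
Cov-++⁺ []      v a∉ _         = Cov-∉ v a∉
Cov-++⁺ (c ∷ u) v a∉ (c≤ , cu) = (λ a∈ → [ c≤ , ⊥-elim ∘ a∉ ]′ (∈-++⁻ u a∈)) , Cov-++⁺ u v a∉ cu

Cov-++⁻ : ∀ {a} u v → Cov a (u ++ v) → Cov a u
Cov-++⁻ []      v _        = tt
Cov-++⁻ (c ∷ u) v (c≤ , cu) = c≤ ∘ ∈-++⁺ˡ , Cov-++⁻ u v cu

Cov-between : ∀ {a m} u v → Cov a (u ++ m ∷ v) → a ∈ v → m ≤ a
Cov-between []      v (m≤ , _) a∈ = m≤ a∈
Cov-between (c ∷ u) v (_ , cu) a∈ = Cov-between u v cu a∈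

Nest-++⁺ : ∀ u v → Nest u → Nest v → Disjoint u v → Nest (u ++ v)
Nest-++⁺ []      v _         nv d = nv
Nest-++⁺ (a ∷ u) v (ca , nu) nv d =
  Cov-++⁺ u v (λ a∈v → d (here refl , a∈v)) ca , Nest-++⁺ u v nu nv (λ (x∈u , x∈v) → d (there x∈u , x∈v))

Nest-++⁻ˡ : ∀ u v → Nest (u ++ v) → Nest u
Nest-++⁻ˡ []      v _         = tt
Nest-++⁻ˡ (a ∷ u) v (ca , nu) = Cov-++⁻ u v ca , Nest-++⁻ˡ u v nu

Nest-++⁻ʳ : ∀ u v → Nest (u ++ v) → Nest v
Nest-++⁻ʳ []      v nv       = nv
Nest-++⁻ʳ (a ∷ u) v (_ , nu) = Nest-++⁻ʳ u v nu

-- Two copies of a enclose the separator m. In `Nest-join⁻` all block letters are below m, so no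
-- letter can lie in two blocks.
Nest-between : ∀ {a m} u v → Nest (u ++ m ∷ v) → a ∈ u → a ∈ v → m ≤ a
Nest-between (_ ∷ u) v (ca , _) (here refl) a∈v = Cov-between u v ca a∈v
Nest-between (_ ∷ u) v (_ , nu) (there a∈u) a∈v = Nest-between u v nu a∈u a∈v

Positional : Word → Set
Positional w = ∀ (i j k : Fin (length w)) → i Fin.< j → j Fin.< k → lookup w i ≡ lookup w k → lookup w j ≤ lookup w i

Cov-positional⁺ : ∀ a w → (∀ (j k : Fin (length w)) → j Fin.< k → a ≡ lookup w k → lookup w j ≤ a) → Cov a w
Cov-positional⁺ a []      _   = tt
Cov-positional⁺ a (c ∷ w) pos =
  (λ a∈w → pos zero (suc (Any.index a∈w)) (s≤s z≤n) (lookup-index a∈w)) ,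
  Cov-positional⁺ a w (λ j k j<k → pos (suc j) (suc k) (s≤s j<k))

Cov-positional⁻ : ∀ a w → Cov a w → ∀ (j k : Fin (length w)) → j Fin.< k → a ≡ lookup w k → lookup w j ≤ a
Cov-positional⁻ a (c ∷ w) (c≤ , _)  zero    (suc k) _         eq = c≤ (subst (_∈ w) (sym eq) (∈-lookup k))
Cov-positional⁻ a (c ∷ w) (_ , cov) (suc j) (suc k) (s≤s j<k) eq = Cov-positional⁻ a w cov j k j<k eq

Nest-positional⁺ : ∀ w → Positional w → Nest w
Nest-positional⁺ []      _   = tt
Nest-positional⁺ (a ∷ w) pos =
  Cov-positional⁺ a w (λ j k j<k eq → pos zero (suc j) (suc k) (s≤s z≤n) (s≤s j<k) eq) ,
  Nest-positional⁺ w (λ i j k i<j j<k → pos (suc i) (suc j) (suc k) (s≤s i<j) (s≤s j<k))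

Nest-positional⁻ : ∀ w → Nest w → Positional w
Nest-positional⁻ (a ∷ w) (cov , _)  zero    (suc j) (suc k) _         (s≤s j<k) eq = Cov-positional⁻ a w cov j k j<k eq
Nest-positional⁻ (a ∷ w) (_ , nest) (suc i) (suc j) (suc k) (s≤s i<j) (s≤s j<k) eq = Nest-positional⁻ w nest i j k i<j j<k eq

NestL : List Word → Set
NestL []       = ⊤
NestL (w ∷ ws) = Nest w × Disjoint w (concat ws) × NestL ws

∈-concat-++⁻ : ∀ {x : ℕ} us vs → x ∈ concat (us ++ vs) → x ∈ concat us ⊎ x ∈ concat vs
∈-concat-++⁻ us vs x∈ = ∈-++⁻ (concat us) (subst (_ ∈_) (sym (concat-++ us vs)) x∈)

∈-concat-++⁺ˡ : ∀ {x : ℕ} us vs → x ∈ concat us → x ∈ concat (us ++ vs)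
∈-concat-++⁺ˡ us vs x∈ = subst (_ ∈_) (concat-++ us vs) (∈-++⁺ˡ x∈)

∈-concat-++⁺ʳ : ∀ {x : ℕ} us vs → x ∈ concat vs → x ∈ concat (us ++ vs)
∈-concat-++⁺ʳ us vs x∈ = subst (_ ∈_) (concat-++ us vs) (∈-++⁺ʳ (concat us) x∈)

NestL-++⁺ : ∀ us vs → NestL us → NestL vs → Disjoint (concat us) (concat vs) → NestL (us ++ vs)
NestL-++⁺ []       vs _              nv d = nv
NestL-++⁺ (u ∷ us) vs (n , du , nus) nv d =
  n , (λ (x∈u , x∈) → [ (λ x∈us → du (x∈u , x∈us)) , (λ x∈vs → d (∈-++⁺ˡ x∈u , x∈vs)) ]′ (∈-concat-++⁻ us vs x∈)) ,
  NestL-++⁺ us vs nus nv (λ (x∈us , x∈vs) → d (∈-++⁺ʳ u x∈us , x∈vs))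

NestL-++⁻ : ∀ us vs → NestL (us ++ vs) → NestL us × NestL vs × Disjoint (concat us) (concat vs)
NestL-++⁻ []       vs nv             = tt , nv , λ { (() , _) }
NestL-++⁻ (u ∷ us) vs (n , du , nus) with NestL-++⁻ us vs nus
... | nu , nv , d = (n , (λ (x∈u , x∈us) → du (x∈u , ∈-concat-++⁺ˡ us vs x∈us)) , nu) , nv ,
  λ (x∈ , x∈vs) → [ (λ x∈u → du (x∈u , ∈-concat-++⁺ʳ us vs x∈vs)) , (λ x∈us → d (x∈us , x∈vs)) ]′ (∈-++⁻ u x∈)

-- Copies of the maximum do not restrict what lies between them, and disjoint blocks impose nothing
-- on each other.
Nest-join⁺ : ∀ {m} α αs → (∀ {x} → x ∈ concat (α ∷ αs) → x < m) → NestL (α ∷ αs) → Nest (join m α αs)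
Nest-join⁺ α []       <m (n , _ , _)  = n
Nest-join⁺ {m} α (β ∷ βs) <m (n , d , ns) = Nest-++⁺ α (m ∷ join m β βs) n
  (Cov-bounded m (join m β βs) (λ x∈ → [ ℕₚ.≤-reflexive , ℕₚ.<⇒≤ ∘ <m ∘ ∈-++⁺ʳ α ]′ (∈-join⁻ β βs x∈)) ,
   Nest-join⁺ β βs (<m ∘ ∈-++⁺ʳ α) ns)
  λ { (x∈α , here refl)  → ℕₚ.<-irrefl refl (<m (∈-++⁺ˡ x∈α))
    ; (x∈α , there x∈)   → [ (λ { refl → ℕₚ.<-irrefl refl (<m (∈-++⁺ˡ x∈α)) }) , (λ x∈bs → d (x∈α , x∈bs)) ]′ (∈-join⁻ β βs x∈) }

Nest-join⁻ : ∀ {m} α αs → (∀ {x} → x ∈ concat (α ∷ αs) → x < m) → Nest (join m α αs) → NestL (α ∷ αs)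
Nest-join⁻ α []       <m n = n , (λ { (_ , ()) }) , tt
Nest-join⁻ {m} α (β ∷ βs) <m n =
  Nest-++⁻ˡ α (m ∷ join m β βs) n ,
  (λ (x∈α , x∈) → ℕₚ.<⇒≱ (<m (∈-++⁺ˡ x∈α)) (Nest-between α (join m β βs) n x∈α (∈-join⁺ β βs x∈))) ,
  Nest-join⁻ β βs (<m ∘ ∈-++⁺ʳ α) (proj₂ (Nest-++⁻ʳ α (m ∷ join m β βs) n))

-- Intervals of letters

range : ℕ → ℕ → Word
range lo zero    = []
range lo (suc n) = suc lo ∷ range (suc lo) n

length-range : ∀ lo n → length (range lo n) ≡ n
length-range lo zero    = refl
length-range lo (suc n) = cong suc (length-range (suc lo) n)

range-++ : ∀ lo a b → range lo a ++ range (lo ℕ.+ a) b ≡ range lo (a ℕ.+ b)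
range-++ lo zero    b = cong (λ z → range z b) (ℕₚ.+-identityʳ lo)
range-++ lo (suc a) b = cong (suc lo ∷_) (trans (cong (λ z → range (suc lo) a ++ range z b) (ℕₚ.+-suc lo a)) (range-++ (suc lo) a b))

range-∷ʳ : ∀ lo n → range lo n ++ [ suc (lo ℕ.+ n) ] ≡ range lo (suc n)
range-∷ʳ lo n = trans (range-++ lo n 1) (cong (range lo) (ℕₚ.+-comm n 1))

-- Used on the two sorted halves that remain when the final maximum is removed: it forces the left
-- pieces to carry the smallest letters.
range-split : ∀ xs ys lo n → xs ++ ys ≡ range lo n →
              ∃[ a ] ∃[ b ] a ℕ.+ b ≡ n × xs ≡ range lo a × ys ≡ range (lo ℕ.+ a) b
range-split []       ys lo n       eq = 0 , n , refl , refl , trans eq (cong (λ z → range z n) (sym (ℕₚ.+-identityʳ lo)))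
range-split (x ∷ xs) ys lo (suc n) eq with ∷-injective eq
... | refl , eq′ with range-split xs ys (suc lo) n eq′
...   | a , b , refl , refl , refl = suc a , b , refl , refl , cong (λ z → range z b) (sym (ℕₚ.+-suc lo a))

∈-range⁻ : ∀ {x} lo n → x ∈ range lo n → lo < x × x ≤ lo ℕ.+ n
∈-range⁻ lo (suc n) (here refl) = ℕₚ.≤-refl , subst (suc lo ≤_) (sym (ℕₚ.+-suc lo n)) (s≤s (ℕₚ.m≤m+n lo n))
∈-range⁻ {x} lo (suc n) (there x∈) =
  let lo<x , x≤ = ∈-range⁻ (suc lo) n x∈ in ℕₚ.<⇒≤ lo<x , subst (x ≤_) (sym (ℕₚ.+-suc lo n)) x≤

∈-range⁺ : ∀ {x} lo n → lo < x → x ≤ lo ℕ.+ n → x ∈ range lo n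
∈-range⁺ {x} lo zero    lo<x x≤ = ⊥-elim (ℕₚ.<⇒≱ lo<x (subst (x ≤_) (ℕₚ.+-identityʳ lo) x≤))
∈-range⁺ {x} lo (suc n) lo<x x≤ with ℕₚ.m≤n⇒m<n∨m≡n lo<x
... | inj₁ slo<x = there (∈-range⁺ (suc lo) n slo<x (subst (x ≤_) (ℕₚ.+-suc lo n) x≤))
... | inj₂ refl  = here refl

applyUpTo-range : ∀ (f : ℕ → ℕ) lo n → (∀ i → f i ≡ suc (lo ℕ.+ i)) → applyUpTo f n ≡ range lo n
applyUpTo-range f lo zero    eq = refl
applyUpTo-range f lo (suc n) eq = cong₂ _∷_ (trans (eq 0) (cong suc (ℕₚ.+-identityʳ lo)))
  (applyUpTo-range (f ∘ suc) (suc lo) n (λ i → trans (eq (suc i)) (cong suc (ℕₚ.+-suc lo i))))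

-- Removing the largest letter

module Decomposition (m : ℕ) (bs : List Word) (α β : Word) (βs cs : List Word) where
  αs xs zs : List Word
  αs = α ∷ β ∷ βs
  xs = bs ++ αs
  zs = bs ++ join m α (β ∷ βs) ∷ cs

  w : Word
  w = join m α (β ∷ βs)

  letters⁺ˡ : ∀ {x} → x ∈ concat xs → x ∈ concat zs
  letters⁺ˡ x∈ = [ ∈-concat-++⁺ˡ bs (w ∷ cs) , ∈-concat-++⁺ʳ bs (w ∷ cs) ∘ ∈-++⁺ˡ ∘ ∈-join⁺ α (β ∷ βs) ]′ (∈-concat-++⁻ bs αs x∈)

  letters⁺ʳ : ∀ {x} → x ∈ concat cs → x ∈ concat zs
  letters⁺ʳ x∈ = ∈-concat-++⁺ʳ bs (w ∷ cs) (∈-++⁺ʳ w x∈)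

  occ-split : ∀ {a} → m ≢ a → occ a (concat zs) ≡ occ a (concat xs) ℕ.+ occ a (concat cs)
  occ-split {a} m≢a = begin
    occ a (concat zs)
      ≡⟨ cong (occ a) (concat-++ bs (w ∷ cs)) ⟨
    occ a (concat bs ++ w ++ concat cs)
      ≡⟨ trans (occ-++ a (concat bs) (w ++ concat cs)) (cong (occ a (concat bs) ℕ.+_) (occ-++ a w (concat cs))) ⟩
    occ a (concat bs) ℕ.+ (occ a w ℕ.+ occ a (concat cs))
      ≡⟨ ℕₚ.+-assoc (occ a (concat bs)) (occ a w) (occ a (concat cs)) ⟨
    occ a (concat bs) ℕ.+ occ a w ℕ.+ occ a (concat cs)
      ≡⟨ cong (λ z → occ a (concat bs) ℕ.+ z ℕ.+ occ a (concat cs)) (occ-join α (β ∷ βs) m≢a) ⟩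
    occ a (concat bs) ℕ.+ occ a (concat αs) ℕ.+ occ a (concat cs)
      ≡⟨ cong (ℕ._+ occ a (concat cs)) (trans (sym (occ-++ a (concat bs) (concat αs))) (cong (occ a) (concat-++ bs αs))) ⟩
    occ a (concat xs) ℕ.+ occ a (concat cs) ∎
    where open ≡-Reasoning

  module _ (xs< : ∀ {x} → x ∈ concat xs → x < m) (cs< : ∀ {x} → x ∈ concat cs → x < m) where
    m∉xs : m ∉ concat xs
    m∉xs = ℕₚ.<-irrefl refl ∘ xs<

    m∉cs : m ∉ concat cs
    m∉cs = ℕₚ.<-irrefl refl ∘ cs<

    αs< : ∀ {x} → x ∈ concat αs → x < m
    αs< = xs< ∘ ∈-concat-++⁺ʳ bs αs

    occ-max : occ m (concat zs) ≡ suc (length βs)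
    occ-max = begin
      occ m (concat zs)
        ≡⟨ cong (occ m) (concat-++ bs (w ∷ cs)) ⟨
      occ m (concat bs ++ w ++ concat cs)
        ≡⟨ trans (occ-++ m (concat bs) (w ++ concat cs)) (cong (occ m (concat bs) ℕ.+_) (occ-++ m w (concat cs))) ⟩
      occ m (concat bs) ℕ.+ (occ m w ℕ.+ occ m (concat cs))
        ≡⟨ cong₂ (λ y z → y ℕ.+ (occ m w ℕ.+ z)) (occ-∉ (concat bs) (m∉xs ∘ ∈-concat-++⁺ˡ bs αs)) (occ-∉ (concat cs) m∉cs) ⟩
      occ m w ℕ.+ 0
        ≡⟨ trans (ℕₚ.+-identityʳ _) (occ-sep α (β ∷ βs) (ℕₚ.<-irrefl refl ∘ αs<)) ⟩
      suc (length βs) ∎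
      where open ≡-Reasoning

    -- The image of the cut word is the images of its blocks followed by a single m. The word to be
    -- sorted the second time is therefore l m r, with l built from `xs` and r from `cs`.
    SS-split : SS zs ≡ (SS xs ++ SS cs) ++ [ m ]
    SS-split = begin
      S (concatMap S zs)
        ≡⟨ cong S (concatMap-++ S bs (w ∷ cs)) ⟩
      S (concatMap S bs ++ S w ++ concatMap S cs)
        ≡⟨ cong (λ v → S (concatMap S bs ++ v ++ concatMap S cs)) (S-join m α β βs αs<) ⟩
      S (concatMap S bs ++ (concatMap S αs ++ [ m ]) ++ concatMap S cs)
        ≡⟨ cong (λ v → S (concatMap S bs ++ v)) (++-assoc (concatMap S αs) [ m ] (concatMap S cs)) ⟩
      S (concatMap S bs ++ concatMap S αs ++ m ∷ concatMap S cs)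
        ≡⟨ cong S (++-assoc (concatMap S bs) (concatMap S αs) (m ∷ concatMap S cs)) ⟨
      S ((concatMap S bs ++ concatMap S αs) ++ m ∷ concatMap S cs)
        ≡⟨ cong (λ v → S (v ++ m ∷ concatMap S cs)) (concatMap-++ S bs αs) ⟨
      S (join m (concatMap S xs) (concatMap S cs ∷ []))
        ≡⟨ S-join m (concatMap S xs) (concatMap S cs) [] letters< ⟩
      (SS xs ++ SS cs ++ []) ++ [ m ]
        ≡⟨ cong (λ v → (SS xs ++ v) ++ [ m ]) (++-identityʳ (SS cs)) ⟩
      (SS xs ++ SS cs) ++ [ m ] ∎
      where
      open ≡-Reasoning
      letters< : ∀ {x} → x ∈ concat (concatMap S xs ∷ concatMap S cs ∷ []) → x < m
      letters< {x} x∈ = [ xs< ∘ ∈-concatMap-S⁻ xs , cs< ∘ ∈-concatMap-S⁻ cs ]′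
        (∈-++⁻ (concatMap S xs) (subst (λ v → x ∈ concatMap S xs ++ v) (++-identityʳ (concatMap S cs)) x∈))

    NestL-glue : NestL xs → NestL cs → Disjoint (concat xs) (concat cs) → NestL zs
    NestL-glue nxs ncs d with NestL-++⁻ bs αs nxs
    ... | nbs , nαs , bsαs = NestL-++⁺ bs (w ∷ cs) nbs (Nest-join⁺ α (β ∷ βs) αs< nαs , w-cs , ncs) bs-rest
      where
      w-cs : Disjoint w (concat cs)
      w-cs (x∈w , x∈cs) = [ (λ { refl → m∉cs x∈cs }) , (λ x∈αs → d (∈-concat-++⁺ʳ bs αs x∈αs , x∈cs)) ]′ (∈-join⁻ α (β ∷ βs) x∈w)
      bs-rest : Disjoint (concat bs) (concat (w ∷ cs))
      bs-rest (x∈bs , x∈) = [ in-w , (λ x∈cs → d (∈-concat-++⁺ˡ bs αs x∈bs , x∈cs)) ]′ (∈-++⁻ w x∈)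
        where
        in-w = λ x∈w → [ (λ { refl → m∉xs (∈-concat-++⁺ˡ bs αs x∈bs) }) , (λ x∈αs → bsαs (x∈bs , x∈αs)) ]′ (∈-join⁻ α (β ∷ βs) x∈w)

  NestL-cut : (∀ {x} → x ∈ concat αs → x < m) → NestL zs → NestL xs × NestL cs × Disjoint (concat xs) (concat cs)
  NestL-cut αs< nzs with NestL-++⁻ bs (w ∷ cs) nzs
  ... | nbs , (nw , w-cs , ncs) , bs-rest =
    NestL-++⁺ bs αs nbs (Nest-join⁻ α (β ∷ βs) αs< nw)
      (λ (x∈bs , x∈αs) → bs-rest (x∈bs , ∈-++⁺ˡ (∈-join⁺ α (β ∷ βs) x∈αs))) ,
    ncs ,
    (λ (x∈xs , x∈cs) → [ (λ x∈bs → bs-rest (x∈bs , ∈-++⁺ʳ w x∈cs)) , (λ x∈αs → w-cs (∈-join⁺ α (β ∷ βs) x∈αs , x∈cs)) ]′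
      (∈-concat-++⁻ bs αs x∈xs))

-- The bijection behind the recurrence

module Counting (r' : ℕ) where
  r : ℕ
  r = suc r'

  -- The offset `lo` is there because the words to the right of the maximum carry a shifted
  -- interval. As S preserves the set of letters, `sorted` also bounds the letters.
  record Valid (lo n k : ℕ) (ws : List Word) : Set where
    field
      words  : length ws ≡ k
      sorted : SS ws ≡ range lo n
      copies : ∀ {a} → a ∈ range lo n → occ a (concat ws) ≡ r
      nested : NestL ws

    letters : ∀ {x} → x ∈ concat ws → x ∈ range lo n
    letters x∈ = subst (_ ∈_) sorted (∈-SS⁺ ws x∈)

  open Valid

  -- In (i , a , xs , ys) there are i words before the one with the largest letter; xs consists of
  -- these and of the r + 1 blocks of that word, and carries the a smallest letters; ys are the words after it.
  Pieces : ℕ → ℕ → ℕ → ℕ × ℕ × List Word × List Word → Set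
  Pieces lo n k = Antidiagonal (λ i j → Antidiagonal (λ a b (xs , ys) →
    Valid lo a (suc r ℕ.+ i) xs × Valid (lo ℕ.+ a) b j ys) n) k

  -- The value at the empty list is a mere default: on `Pieces`, at least two blocks are left after
  -- the first i words.
  joinAll : ℕ → List Word → Word
  joinAll m []       = []
  joinAll m (α ∷ αs) = join m α αs

  glue : ℕ → ℕ × ℕ × List Word × List Word → List Word
  glue m (i , _ , xs , ys) = take i xs ++ joinAll m (drop i xs) ∷ ys

  length-2+ : ∀ {A : Set} {l} (xs : List A) → length xs ≡ suc (suc l) → ∃[ x ] ∃[ y ] ∃[ zs ] xs ≡ x ∷ y ∷ zs × length zs ≡ l
  length-2+ (x ∷ y ∷ zs) refl = x , y , zs , refl , refl

  -- Beyond the first i words there are r + 1 = 2 + r' blocks; the two that are split off supply the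
  -- separator required by `S-join`.
  cut-at : ∀ i (xs : List Word) → length xs ≡ suc r ℕ.+ i → ∃[ bs ] ∃[ α ] ∃[ β ] ∃[ βs ]
    xs ≡ bs ++ α ∷ β ∷ βs × length bs ≡ i × length βs ≡ r' × take i xs ≡ bs × drop i xs ≡ α ∷ β ∷ βs
  cut-at i xs len with length-2+ (drop i xs) (trans (length-drop i xs) (trans (cong (ℕ._∸ i) len) (ℕₚ.m+n∸n≡m (suc r) i)))
  ... | α , β , βs , eq , lenβs = take i xs , α , β , βs ,
    trans (sym (take++drop≡id i xs)) (cong (take i xs ++_) eq) ,
    trans (length-take i xs) (trans (cong (i ℕ.⊓_) len) (ℕₚ.m≤n⇒m⊓n≡m (ℕₚ.m≤n+m i (suc r)))) ,
    lenβs , refl , eq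

  take-++ : ∀ {A : Set} (bs as : List A) → take (length bs) (bs ++ as) ≡ bs
  take-++ []       as = refl
  take-++ (b ∷ bs) as = cong (b ∷_) (take-++ bs as)

  drop-++ : ∀ {A : Set} (bs as : List A) → drop (length bs) (bs ++ as) ≡ as
  drop-++ []       as = refl
  drop-++ (b ∷ bs) as = drop-++ bs as

  module _ {lo a b n : ℕ} (a+b : a ℕ.+ b ≡ n) where
    low< : ∀ {x} → x ∈ range lo a → x < suc (lo ℕ.+ n)
    low< x∈ = s≤s (ℕₚ.≤-trans (proj₂ (∈-range⁻ lo a x∈)) (ℕₚ.+-monoʳ-≤ lo (subst (a ≤_) a+b (ℕₚ.m≤m+n a b))))

    high< : ∀ {x} → x ∈ range (lo ℕ.+ a) b → x < suc (lo ℕ.+ n)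
    high< {x} x∈ = s≤s (subst (x ≤_) (trans (ℕₚ.+-assoc lo a b) (cong (lo ℕ.+_) a+b)) (proj₂ (∈-range⁻ (lo ℕ.+ a) b x∈)))

    low-high : Disjoint (range lo a) (range (lo ℕ.+ a) b)
    low-high (x∈a , x∈b) = ℕₚ.<⇒≱ (proj₁ (∈-range⁻ (lo ℕ.+ a) b x∈b)) (proj₂ (∈-range⁻ lo a x∈a))

    range-max : (range lo a ++ range (lo ℕ.+ a) b) ++ [ suc (lo ℕ.+ n) ] ≡ range lo (suc n)
    range-max = trans (cong (_++ [ suc (lo ℕ.+ n) ]) (trans (range-++ lo a b) (cong (range lo) a+b))) (range-∷ʳ lo n)

  glue-valid : ∀ {lo n k} q → Pieces lo n k q → Valid lo (suc n) (suc k) (glue (suc (lo ℕ.+ n)) q)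
  glue-valid {lo} {n} {k} (i , a , xs , ys) (j , i+j , b , a+b , vx , vy) with cut-at i xs (words vx)
  ... | bs , α , β , βs , refl , lenbs , lenβs , eqt , eqd rewrite eqt | eqd = record
    { words  = trans (length-++ bs) (trans (cong₂ ℕ._+_ lenbs (cong suc (words vy))) (trans (ℕₚ.+-suc i j) (cong suc i+j)))
    ; sorted = trans (SS-split xs< ys<) (trans (cong₂ (λ u v → (u ++ v) ++ [ m ]) (sorted vx) (sorted vy)) (range-max {a = a} {b = b} a+b))
    ; copies = λ {c} c∈ → copies′ c (∈-++⁻ (range lo a ++ range (lo ℕ.+ a) b) (subst (c ∈_) (sym (range-max {a = a} {b = b} a+b)) c∈))
    ; nested = NestL-glue xs< ys< (nested vx) (nested vy) xs-ys }
    where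
    m = suc (lo ℕ.+ n)
    open Decomposition m bs α β βs ys using (zs; SS-split; NestL-glue; occ-split; occ-max)
    xs< : ∀ {x} → x ∈ concat xs → x < m
    xs< = low< a+b ∘ letters vx
    ys< : ∀ {x} → x ∈ concat ys → x < m
    ys< = high< a+b ∘ letters vy
    xs-ys : Disjoint (concat xs) (concat ys)
    xs-ys (x∈xs , x∈ys) = low-high a+b (letters vx x∈xs , letters vy x∈ys)
    copies′ : ∀ c → c ∈ range lo a ++ range (lo ℕ.+ a) b ⊎ c ∈ [ m ] → occ c (concat zs) ≡ r
    copies′ c (inj₂ (here refl)) = trans (occ-max xs< ys<) (cong suc lenβs)
    copies′ c (inj₁ c∈) with ∈-++⁻ (range lo a) c∈
    ... | inj₁ c∈a = trans (occ-split (λ { refl → ℕₚ.<-irrefl refl (low< a+b c∈a) }))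
      (trans (cong₂ ℕ._+_ (copies vx c∈a) (occ-∉ (concat ys) (λ c∈ys → low-high a+b (c∈a , letters vy c∈ys)))) (ℕₚ.+-identityʳ r))
    ... | inj₂ c∈b = trans (occ-split (λ { refl → ℕₚ.<-irrefl refl (high< a+b c∈b) }))
      (cong₂ ℕ._+_ (occ-∉ (concat xs) (λ c∈xs → low-high a+b (letters vx c∈xs , c∈b))) (copies vy c∈b))

  word-split : ∀ {x : ℕ} ws → x ∈ concat ws → ∃[ bs ] ∃[ w ] ∃[ cs ] ws ≡ bs ++ w ∷ cs × x ∈ w
  word-split ws x∈ with ∈-concat⁻′ ws x∈
  ... | w , x∈w , w∈ws with ∈-∃++ w∈ws
  ...   | bs , cs , eq = bs , w , cs , eq , x∈w

  glue-surjective : ∀ {lo n k zs} → Valid lo (suc n) (suc k) zs → ∃[ q ] Pieces lo n k q × zs ≡ glue (suc (lo ℕ.+ n)) q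
  glue-surjective {lo} {n} {k} {zs} v = go (word-split zs m∈zs)
    where
    m = suc (lo ℕ.+ n)
    m∈range : m ∈ range lo (suc n)
    m∈range = subst (m ∈_) (range-∷ʳ lo n) (∈-++⁺ʳ (range lo n) (here refl))
    m∈zs : m ∈ concat zs
    m∈zs = occ-∈ (concat zs) (subst (1 ≤_) (sym (copies v m∈range)) (s≤s z≤n))
    zs≤ : ∀ {x} → x ∈ concat zs → x ≤ m
    zs≤ {x} x∈ = subst (x ≤_) (ℕₚ.+-suc lo n) (proj₂ (∈-range⁻ lo (suc n) (letters v x∈)))
    go : ∃[ bs ] ∃[ w ] ∃[ cs ] zs ≡ bs ++ w ∷ cs × m ∈ w → ∃[ q ] Pieces lo n k q × zs ≡ glue m q
    go (bs , w , cs , refl , m∈w) with unjoin m w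
    ... | α , []     , refl , m∉αs = ⊥-elim (m∉αs (∈-++⁺ˡ m∈w))
    ... | α , β ∷ βs , refl , m∉αs = pieces
      where
      open Decomposition m bs α β βs cs using (αs; xs; SS-split; NestL-cut; occ-split; occ-max; letters⁺ˡ; letters⁺ʳ)
      αs< : ∀ {x} → x ∈ concat αs → x < m
      αs< x∈ = ℕₚ.≤∧≢⇒< (zs≤ (letters⁺ˡ (∈-concat-++⁺ʳ bs αs x∈))) (λ { refl → m∉αs x∈ })
      nests : NestL bs × NestL (join m α (β ∷ βs) ∷ cs) × Disjoint (concat bs) (concat (join m α (β ∷ βs) ∷ cs))
      nests = NestL-++⁻ bs (join m α (β ∷ βs) ∷ cs) (nested v)
      -- Distinct words share no letter, so m, which lies in the cut word, is absent from `bs` and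
      -- likewise from `cs`.
      bs< : ∀ {x} → x ∈ concat bs → x < m
      bs< x∈ = ℕₚ.≤∧≢⇒< (zs≤ (letters⁺ˡ (∈-concat-++⁺ˡ bs αs x∈))) (λ { refl → proj₂ (proj₂ nests) (x∈ , ∈-++⁺ˡ m∈w) })
      xs< : ∀ {x} → x ∈ concat xs → x < m
      xs< x∈ = [ bs< , αs< ]′ (∈-concat-++⁻ bs αs x∈)
      cs< : ∀ {x} → x ∈ concat cs → x < m
      cs< x∈ = ℕₚ.≤∧≢⇒< (zs≤ (letters⁺ʳ x∈)) (λ { refl → proj₁ (proj₂ (proj₁ (proj₂ nests))) (m∈w , x∈) })
      halves : SS xs ++ SS cs ≡ range lo n
      halves = proj₁ (∷ʳ-injective (SS xs ++ SS cs) (range lo n)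
        (trans (sym (SS-split xs< cs<)) (trans (sorted v) (sym (range-∷ʳ lo n)))))
      pieces : ∃[ q ] Pieces lo n k q × bs ++ join m α (β ∷ βs) ∷ cs ≡ glue m q
      pieces with range-split (SS xs) (SS cs) lo n halves | NestL-cut αs< (nested v)
      ... | a , b , a+b , sx , sc | nx , nc , dxc =
        (length bs , a , xs , cs) , (length cs , lengths , b , a+b , vx , vc) ,
        cong₂ (λ us vs → us ++ joinAll m vs ∷ cs) (sym (take-++ bs αs)) (sym (drop-++ bs αs))
        where
        lengths : length bs ℕ.+ length cs ≡ k
        lengths = ℕₚ.suc-injective (trans (sym (ℕₚ.+-suc (length bs) (length cs))) (trans (sym (length-++ bs)) (words v)))
        in-range : ∀ {c} → c ∈ range lo a ++ range (lo ℕ.+ a) b → c ∈ range lo (suc n)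
        in-range {c} c∈ = subst (c ∈_) (range-max {a = a} {b = b} a+b) (∈-++⁺ˡ c∈)
        vx : Valid lo a (suc r ℕ.+ length bs) xs
        vx = record
          -- The blocks are one more than the separators, and the separators are the r copies of m.
          { words  = trans (length-++ bs) (trans (cong (λ l → length bs ℕ.+ suc l)
              (trans (sym (occ-max xs< cs<)) (copies v m∈range))) (ℕₚ.+-comm (length bs) (suc r)))
          ; sorted = sx
          ; copies = λ {c} c∈ → trans (sym (ℕₚ.+-identityʳ _)) (trans
              (cong (occ c (concat xs) ℕ.+_)
                (sym (occ-∉ (concat cs) (λ c∈cs → low-high a+b (c∈ , subst (c ∈_) sc (∈-SS⁺ cs c∈cs))))))
              (trans (sym (occ-split (λ { refl → ℕₚ.<-irrefl refl (low< a+b c∈) }))) (copies v (in-range (∈-++⁺ˡ c∈)))))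
          ; nested = nx }
        vc : Valid (lo ℕ.+ a) b (length cs) cs
        vc = record
          { words  = refl
          ; sorted = sc
          ; copies = λ {c} c∈ → trans
              (cong (ℕ._+ occ c (concat cs))
                (sym (occ-∉ (concat xs) (λ c∈xs → low-high a+b (subst (c ∈_) sx (∈-SS⁺ xs c∈xs) , c∈)))))
              (trans (sym (occ-split (λ { refl → ℕₚ.<-irrefl refl (high< a+b c∈) }))) (copies v (in-range (∈-++⁺ʳ (range lo a) c∈))))
          ; nested = nc }

  -- On both sides the distinguished word is the first one that contains x.
  word-position : ∀ {x : ℕ} bs bs' {w w' cs cs'} → x ∉ concat bs → x ∉ concat bs' → x ∈ w → x ∈ w' →
                  bs ++ w ∷ cs ≡ bs' ++ w' ∷ cs' → bs ≡ bs' × w ≡ w' × cs ≡ cs'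
  word-position []       []         _    _    _   _    refl = refl , refl , refl
  word-position []       (_ ∷ bs')  _    x∉′  x∈w _    refl = ⊥-elim (x∉′ (∈-++⁺ˡ x∈w))
  word-position (_ ∷ bs) []         x∉   _    _   x∈w′ refl = ⊥-elim (x∉ (∈-++⁺ˡ x∈w′))
  word-position (b ∷ bs) (b' ∷ bs') x∉   x∉′  x∈w x∈w′ eq with ∷-injective eq
  ... | refl , eq′ with word-position bs bs' (x∉ ∘ ∈-++⁺ʳ b) (x∉′ ∘ ∈-++⁺ʳ b) x∈w x∈w′ eq′
  ...   | refl , refl , refl = refl , refl , refl

  -- The largest letter marks the glued word and so recovers i, `splitOn` recovers the blocks, and a
  -- is the length of the sorted word `SS xs`.
  glue-injective : ∀ {lo n k q q'} → Pieces lo n k q → Pieces lo n k q' →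
                   glue (suc (lo ℕ.+ n)) q ≡ glue (suc (lo ℕ.+ n)) q' → q ≡ q'
  glue-injective {lo} {n} {k} {i , a , xs , ys} {i' , a' , xs' , ys'}
    (j , i+j , b , a+b , vx , vy) (j' , i+j' , b' , a+b' , vx' , vy') eq
    with cut-at i xs (words vx) | cut-at i' xs' (words vx')
  ... | bs , α , β , βs , refl , lenbs , _ , eqt , eqd | bs' , α' , β' , βs' , refl , lenbs' , _ , eqt' , eqd'
    rewrite eqt | eqd | eqt' | eqd' = go (word-position bs bs' (m∉ ∘ ∈-concat-++⁺ˡ bs (α ∷ β ∷ βs)) (m∉' ∘ ∈-concat-++⁺ˡ bs' (α' ∷ β' ∷ βs'))
      (sep-∈ m α β βs) (sep-∈ m α' β' βs') eq)
    where
    m = suc (lo ℕ.+ n)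
    m∉ : m ∉ concat (bs ++ α ∷ β ∷ βs)
    m∉ m∈ = ℕₚ.<-irrefl refl (low< a+b (letters vx m∈))
    m∉' : m ∉ concat (bs' ++ α' ∷ β' ∷ βs')
    m∉' m∈ = ℕₚ.<-irrefl refl (low< a+b' (letters vx' m∈))
    go : bs ≡ bs' × join m α (β ∷ βs) ≡ join m α' (β' ∷ βs') × ys ≡ ys' →
         (i , a , bs ++ α ∷ β ∷ βs , ys) ≡ (i' , a' , bs' ++ α' ∷ β' ∷ βs' , ys')
    go (refl , eqw , refl) with trans (sym (splitOn-join m α (β ∷ βs) (m∉ ∘ ∈-concat-++⁺ʳ bs (α ∷ β ∷ βs))))
                                 (trans (cong (splitOn m) eqw) (splitOn-join m α' (β' ∷ βs') (m∉' ∘ ∈-concat-++⁺ʳ bs (α' ∷ β' ∷ βs'))))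
    ... | refl = cong₂ (λ x y → x , y , bs ++ α ∷ β ∷ βs , ys) (trans (sym lenbs) lenbs')
      (trans (sym (length-range lo a)) (trans (cong length (trans (sym (sorted vx)) (sorted vx'))) (length-range lo a')))

  empty-words : ∀ ws → (∀ {x : ℕ} → x ∉ concat ws) → ws ≡ replicate (length ws) []
  empty-words []             _  = refl
  empty-words ([] ∷ ws)      x∉ = cong ([] ∷_) (empty-words ws x∉)
  empty-words ((x ∷ w) ∷ ws) x∉ = ⊥-elim (x∉ (here refl))

  empties-valid : ∀ lo k → Valid lo 0 k (replicate k [])
  empties-valid lo k = record
    { words = length-replicate k ; sorted = cong S (S-empties k) ; copies = λ () ; nested = nest-empties k }
    where
    S-empties : ∀ k → concatMap S (replicate k []) ≡ []
    S-empties zero    = refl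
    S-empties (suc k) = S-empties k
    nest-empties : ∀ k → NestL (replicate k [])
    nest-empties zero    = tt
    nest-empties (suc k) = tt , (λ { (() , _) }) , nest-empties k

  Good : ℕ → Word → Set
  Good n π = IsRPerm r n π × S (S π) ≡ idPerm n

  idPerm-range : ∀ n → idPerm n ≡ range 0 n
  idPerm-range n = applyUpTo-range suc 0 n (λ _ → refl)

  SS-single : ∀ π → SS (π ∷ []) ≡ S (S π)
  SS-single π = cong S (++-identityʳ (S π))

  valid⇒good : ∀ {n π} → Valid 0 n 1 (π ∷ []) → Good n π
  valid⇒good {n} {π} v = (bounds , copies′ , Nest-positional⁻ π (proj₁ (nested v))) ,
    trans (sym (SS-single π)) (trans (sorted v) (sym (idPerm-range n)))
    where
    bounds : ∀ a → a ∈ π → 1 ≤ a × a ≤ n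
    bounds a a∈ = ∈-range⁻ 0 n (letters v (∈-++⁺ˡ a∈))
    copies′ : ∀ a → 1 ≤ a → a ≤ n → occ a π ≡ r
    copies′ a 1≤a a≤n = trans (cong (occ a) (sym (++-identityʳ π))) (copies v (∈-range⁺ 0 n 1≤a a≤n))

  good⇒valid : ∀ {n π} → Good n π → Valid 0 n 1 (π ∷ [])
  good⇒valid {n} {π} ((_ , copies′ , pos) , ssπ) = record
    { words  = refl
    ; sorted = trans (SS-single π) (trans ssπ (idPerm-range n))
    ; copies = λ {a} a∈ → let 1≤a , a≤n = ∈-range⁻ 0 n a∈ in trans (cong (occ a) (++-identityʳ π)) (copies′ a 1≤a a≤n)
    ; nested = Nest-positional⁺ π pos , (λ { (_ , ()) }) , tt }

  module Recurrence (count : ℕ → ℕ → ℤ)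
    (count-no-letters : ∀ k → count 0 k ≡ 1ℤ)
    (count-no-words : ∀ n → count (suc n) 0 ≡ 0ℤ)
    (count-recurrence : ∀ n k → count (suc n) (suc k)
       ≡ conv (λ i j → conv (λ a b → count a (suc r ℕ.+ i) ℤ.* count b j) n) k)
    where
    -- Only the number of letters decreases: the left half may have more words than the whole list,
    -- and the right half has a larger offset. So `lo` and `k` are quantified inside the induction
    -- on n.
    enumerate : ∀ n lo k → Enumeration (Valid lo n k) (count n k)
    enumerate = <-rec (λ n → ∀ lo k → Enumeration (Valid lo n k) (count n k)) step
      where
      step : ∀ n → (∀ {a} → a < n → ∀ lo k → Enumeration (Valid lo a k) (count a k)) → ∀ lo k → Enumeration (Valid lo n k) (count n k)
      step zero rec lo k = subst (Enumeration _) (sym (count-no-letters k))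
        (enum-one (replicate k []) (empties-valid lo k) (λ {ws} v → trans (empty-words ws (λ x∈ → none (letters v x∈)))
          (cong (λ l → replicate l []) (words v))))
        where
        none : ∀ {x} → x ∉ range lo 0
        none ()
      step (suc n) rec lo zero = subst (Enumeration _) (sym (count-no-words n)) (enum-none no-words)
        where
        no-words : ∀ ws → ¬ Valid lo (suc n) 0 ws
        no-words [] v with sorted v
        ... | ()
        no-words (_ ∷ _) v with words v
        ... | ()
      step (suc n) rec lo (suc k) = subst (Enumeration _) (sym (count-recurrence n k))
        (enum-map (glue (suc (lo ℕ.+ n)))
          (enum-conv _ _ k (λ i j _ → enum-conv _ _ n (λ a b a+b →
            enum-× (rec (s≤s (subst (a ≤_) a+b (ℕₚ.m≤m+n a b))) lo (suc r ℕ.+ i))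
                   (rec (s≤s (subst (b ≤_) a+b (ℕₚ.m≤n+m b a))) (lo ℕ.+ a) j))))
          (glue-valid _) glue-surjective glue-injective)

    enumerate-good : ∀ n → Enumeration (Good n) (count n 1)
    enumerate-good n = enum-map concat (enumerate n 0 1) sound′ complete′ injective
      where
      single : ∀ {ws} → Valid 0 n 1 ws → ws ≡ concat ws ∷ []
      single {w ∷ []} v = cong (_∷ []) (sym (++-identityʳ w))
      single {[]}        v with words v
      ... | ()
      single {_ ∷ _ ∷ _} v with words v
      ... | ()
      sound′ : ∀ {ws} → Valid 0 n 1 ws → Good n (concat ws)
      sound′ v = valid⇒good (subst (Valid 0 n 1) (single v) v)
      complete′ : ∀ {π} → Good n π → ∃[ ws ] Valid 0 n 1 ws × π ≡ concat ws
      complete′ {π} g = π ∷ [] , good⇒valid g , sym (++-identityʳ π)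
      injective : ∀ {ws ws'} → Valid 0 n 1 ws → Valid 0 n 1 ws' → concat ws ≡ concat ws' → ws ≡ ws'
      injective v v' eq = trans (single v) (trans (cong (_∷ []) eq) (sym (single v')))

-- From integer sizes to the equation in natural numbers

open import Data.Nat using (_+_; _*_)

cast-count : ∀ {z} l a b c d → + l ≡ z → z ℤ.* (+ a ℤ.* + b) ≡ + c ℤ.* + d → l * (a * b) ≡ c * d
cast-count l a b c d refl eq = ℤₚ.+-injective (trans (ℤₚ.pos-* l (a * b))
  (trans (cong (+ l ℤ.*_) (ℤₚ.pos-* a b)) (trans eq (sym (ℤₚ.pos-* c d)))))

enumeration⇒count : ∀ {A : Set} {P : A → Set} {z a b c d} → Enumeration P z → z ℤ.* (+ a ℤ.* + b) ≡ + c ℤ.* + d →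
  Σ (List A) λ L → Unique L × (∀ x → x ∈ L ⇔ P x) × length L * (a * b) ≡ c * d
enumeration⇒count {a = a} {b} {c} {d} e eq =
  list e , unique e , (λ x → mk⇔ (sound e) (complete e)) , cast-count (length (list e)) a b c d (size e) eq

theorem5 : (r n : ℕ) → 1 ≤ r → 1 ≤ n →
    Σ (List (List ℕ)) λ L →
    Unique L
    × (∀ π → π ∈ L ⇔ (IsRPerm r n π × S (S π) ≡ idPerm n))
    × length L * (n ! * (2 * r * n + 2) !) ≡ 2 * (r + 1) * ((2 * r + 1) * n) !
theorem5 (suc r') (suc n') _ _ =
  enumeration⇒count {a = n !} {(2 * r * n + 2) !} {2 * (r + 1)} {((2 * r + 1) * n) !}
    (Counting.Recurrence.enumerate-good r' count count-no-letters count-no-words count-recurrence n) (count-closed n')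
  where
  r = suc r'
  n = suc n'
  open Coefficients r
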